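{- Let $\mathcal{C}\le\mathcal{G}=\mathbb{Z}_2^{k_1}\times\mathbb{Z}_4^{k_2}\times Q_8^{k_3}$ be such that $C=\Phi(\mathcal{C})$ is a binary Hadamard code of length $2^m$, let $\mathcal{A}=\mathcal{A}(\mathcal{C})$ be its standard abelian subgroup and $2^\upsilon=|\mathcal{C}/\mathcal{A}|$. If $\upsilon=1$, then $\Phi(\mathcal{A})$ is a duplication of a Hadamard $\mathbb{Z}_2\mathbb{Z}_4$-linear code; if $\upsilon=2$, then $\Phi(\mathcal{A})$ is a quadruplication of a Hadamard $\mathbb{Z}_4$-linear code.
   Context: $Q_8=\langle \mathbf{a},\mathbf{b} : \mathbf{a}^4=\mathbf{a}^2\mathbf{b}^2=\mathbf{1},\ \mathbf{b}\mathbf{a}\mathbf{b}^{ -1}=\mathbf{a}^{ -1}\rangle$; $\mathcal{G}$ is written multiplicatively with identity $\mathbf{e}$, and $\mathbf{u}=(1,\dots,1,2,\dots,2,\mathbf{a}^2,\dots,\mathbf{a}^2)\in\mathcal{G}$. The Gray map $\Phi$ acts componentwise: identity on $\mathbb{Z}_2$; $0\mapsto00,1\mapsto01,2\mapsto11,3\mapsto10$ on $\mathbb{Z}_4$; $\mathbf{1}\mapsto0000$, $\mathbf{b}\mapsto0110$, $\mathbf{a}\mapsto0101$, $\mathbf{a}\mathbf{b}\mapsto1100$, $\mathbf{a}^2\mapsto1111$, $\mathbf{a}^2\mathbf{b}\mapsto1001$, $\mathbf{a}^3\mapsto1010$, $\mathbf{a}^3\mathbf{b}\mapsto0011$ on $Q_8$.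 A binary Hadamard code of length $n$ is the set of rows of a normalized binary Hadamard matrix of order $n$ together with their complements. A Hadamard $\mathbb{Z}_2\mathbb{Z}_4$-linear code is $\Phi(\mathcal{D})$ for a subgroup $\mathcal{D}\le\mathbb{Z}_2^{a}\times\mathbb{Z}_4^{b}$ with $\Phi(\mathcal{D})$ a Hadamard code; it is $\mathbb{Z}_4$-linear if $a=0$. "Duplication" (resp. "quadruplication") of a code $D$ means the code $\{(v,v):v\in D\}$ (resp. $\{(v,v,v,v):v\in D\}$), up to a permutation of coordinates, i.e. every coordinate column is repeated twice (resp. four times). $[a,b]$ denotes the commutator: $ab=[a,b]ba$. $T(\mathcal{C})$ is the subgroup of elements of order $\le2$, $Z(\mathcal{C})$ the center. Normalized generators (from earlier work): $\mathcal{C}=\langle x_1,\dots,x_\sigma;y_1,\dots,y_\delta;z_1,\dots,z_\rho\rangle$ with $T(\mathcal{C})=\langle x_i\rangle$ of order $2^\sigma$, $Z(\mathcal{C})=\langle x_i,y_j\rangle$, $|Z(\mathcal{C})/T(\mathcal{C})|=2^\delta$, $|\mathcal{C}/Z(\mathcal{C})|=2^\rho$, and $\mathcal{C}$ has one of the shapes: (1) $\rho=0$ and $\mathbf{u}$ is not the square of an element of $\mathcal{C}$; (1*) $\rho=0$ and $\mathbf{u}$ is such a square; (2) $\delta=0$, $z_1^2=z_2^2=[z_1,z_2]=\mathbf{u}$, $[z_i,z_j]=z_j^2$, $[z_j,z_k]=\mathbf{e}$ for $i\in\{1,2\}$, $3\le j,k\le\rho$; (3) $\delta=0$, $z_1^2=\mathbf{u}\notin\langle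 z_2^2,\dots,z_\rho^2\rangle$, $[z_1,z_i]=z_i^2$, $[z_i,z_j]=\mathbf{e}$ for $i\ne j$ in $\{2,\dots,\rho\}$; (4) $\delta=0$, $\rho=2$, $z_1^2=z_2^2=[z_1,z_2]\ne\mathbf{u}$; (4*) $\delta=1$, $\rho=2$, $z_1^2=z_2^2=[z_1,z_2]\ne\mathbf{u}$; (5) $\delta=0$, $\rho=4$, $z_1^2=z_2^2=[z_1,z_2]=\mathbf{u}\ne z_3^2=z_4^2=[z_3,z_4]$, $[z_i,z_j]\in\langle z_j^2\rangle$ for $i\in\{1,2\},j\in\{3,4\}$. Standard abelian subgroup: $\mathcal{A}(\mathcal{C})=\mathcal{C}$ in shapes 1, 1*; $\langle T(\mathcal{C}),z_1z_2,z_3,\dots,z_\rho\rangle$ in shape 2; $\langle T(\mathcal{C}),z_2,\dots,z_\rho\rangle$ in shape 3; $\langle T(\mathcal{C}),z_1\rangle$ in shape 4; $\langle T(\mathcal{C}),y_1z_1,z_1\rangle$ in shape 4*; $\langle T(\mathcal{C}),z_1,f(z_1)\rangle$ in shape 5, where $f(z)=z_3$ if $[z,z_3]=\mathbf{e}$, $f(z)=z_4$ if $[z,z_4]=\mathbf{e}$, and $f(z)=z_3z_4$ otherwise. -}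

module Defs where

open import Data.Bool using (Bool; true; false; not; _xor_)
open import Data.Nat using (ℕ; zero; suc; _+_; _*_; _^_)
open import Data.Integer as ℤ using (ℤ; +_; -[1+_])
open import Data.Fin using (Fin; toℕ)
import Data.Fin as Fin
open import Data.Vec using (Vec; []; _∷_; _++_; map; zipWith; replicate; concat; tabulate; lookup)
open import Data.List using (List; []; _∷_; length) renaming (_++_ to _++ˡ_; map to mapˡ)
open import Data.List.Membership.Propositional using (_∈_)
open import Data.List.Relation.Unary.Unique.Propositional using (Unique)
open import Data.Product using (Σ; _×_; _,_)
open import Data.Sum using (_⊎_)
open import Relation.Binary.PropositionalEquality using (_≡_; _≢_)
open import Relation.Nullary using (¬_)

Iff : Set → Set → Set
Iff A B = (A → B) × (B → A)

_≐_ : {A : Set} → (A → Set) → (A → Set) → Set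
P ≐ Q = ∀ a → Iff (P a) (Q a)

HasSize : {A : Set} → (A → Set) → ℕ → Set
HasSize {A} P n = Σ (List A) λ l → Unique l × length l ≡ n × (∀ a → Iff (P a) (a ∈ l))

data Z4 : Set where
  c0 c1 c2 c3 : Z4

inc4 : Z4 → Z4
inc4 c0 = c1
inc4 c1 = c2
inc4 c2 = c3
inc4 c3 = c0

add4 : Z4 → Z4 → Z4
add4 c0 y = y
add4 c1 y = inc4 y
add4 c2 y = inc4 (inc4 y)
add4 c3 y = inc4 (inc4 (inc4 y))

neg4 : Z4 → Z4
neg4 c0 = c0
neg4 c1 = c3
neg4 c2 = c2
neg4 c3 = c1

-- Q8: the element a^i b^j is written  q8 i j  (j = true means one factor b)
-- relations: a^4 = 1, b^2 = a^2, b a b^-1 = a^-1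

record Q8 : Set where
  constructor q8
  field
    apow : Z4
    bpow : Bool

q8mul : Q8 → Q8 → Q8
q8mul (q8 i false) (q8 k l)     = q8 (add4 i k) l
q8mul (q8 i true)  (q8 k false) = q8 (add4 i (neg4 k)) true
q8mul (q8 i true)  (q8 k true)  = q8 (add4 (add4 i (neg4 k)) c2) false

q8inv : Q8 → Q8
q8inv (q8 i false) = q8 (neg4 i) false
q8inv (q8 i true)  = q8 (add4 i c2) true

-- The ambient group  G = Z2^k1 × Z4^k2 × Q8^k3  (written multiplicatively)
-- Z2 is represented by Bool (false = 0, true = 1), with xor.

G : ℕ → ℕ → ℕ → Set
G k1 k2 k3 = Vec Bool k1 × Vec Z4 k2 × Vec Q8 k3

_·_ : ∀ {k1 k2 k3} → G k1 k2 k3 → G k1 k2 k3 → G k1 k2 k3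
(x , y , z) · (x' , y' , z') = zipWith _xor_ x x' , zipWith add4 y y' , zipWith q8mul z z'

e : ∀ {k1 k2 k3} → G k1 k2 k3
e = replicate _ false , replicate _ c0 , replicate _ (q8 c0 false)

_⁻¹ : ∀ {k1 k2 k3} → G k1 k2 k3 → G k1 k2 k3
(x , y , z) ⁻¹ = x , map neg4 y , map q8inv z

sq : ∀ {k1 k2 k3} → G k1 k2 k3 → G k1 k2 k3
sq g = g · g

comm : ∀ {k1 k2 k3} → G k1 k2 k3 → G k1 k2 k3 → G k1 k2 k3
comm a b = ((a · b) · (a ⁻¹)) · (b ⁻¹)

u : ∀ {k1 k2 k3} → G k1 k2 k3
u = replicate _ true , replicate _ c2 , replicate _ (q8 c2 false)

record IsSubgroup {k1 k2 k3} (C : G k1 k2 k3 → Set) : Set where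
  field
    has-e   : C e
    mul-cl  : ∀ {g h} → C g → C h → C (g · h)
    inv-cl  : ∀ {g} → C g → C (g ⁻¹)

data Gen {k1 k2 k3} (S : List (G k1 k2 k3)) : G k1 k2 k3 → Set where
  gen-e   : Gen S e
  gen-mul : ∀ {g h} → g ∈ S → Gen S h → Gen S (g · h)
  gen-inv : ∀ {g h} → g ∈ S → Gen S h → Gen S ((g ⁻¹) · h)

T : ∀ {k1 k2 k3} → (G k1 k2 k3 → Set) → G k1 k2 k3 → Set
T C g = C g × sq g ≡ e

Z : ∀ {k1 k2 k3} → (G k1 k2 k3 → Set) → G k1 k2 k3 → Set
Z C g = C g × (∀ h → C h → g · h ≡ h · g)

ΦZ4 : Z4 → Vec Bool 2
ΦZ4 c0 = false ∷ false ∷ []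
ΦZ4 c1 = false ∷ true ∷ []
ΦZ4 c2 = true ∷ true ∷ []
ΦZ4 c3 = true ∷ false ∷ []

ΦQ8 : Q8 → Vec Bool 4
ΦQ8 (q8 c0 false) = false ∷ false ∷ false ∷ false ∷ []
ΦQ8 (q8 c0 true)  = false ∷ true ∷ true ∷ false ∷ []
ΦQ8 (q8 c1 false) = false ∷ true ∷ false ∷ true ∷ []
ΦQ8 (q8 c1 true)  = true ∷ true ∷ false ∷ false ∷ []
ΦQ8 (q8 c2 false) = true ∷ true ∷ true ∷ true ∷ []
ΦQ8 (q8 c2 true)  = true ∷ false ∷ false ∷ true ∷ []
ΦQ8 (q8 c3 false) = true ∷ false ∷ true ∷ false ∷ []
ΦQ8 (q8 c3 true)  = false ∷ false ∷ true ∷ true ∷ []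

len : ℕ → ℕ → ℕ → ℕ
len k1 k2 k3 = k1 + (k2 * 2 + k3 * 4)

Φ : ∀ {k1 k2 k3} → G k1 k2 k3 → Vec Bool (len k1 k2 k3)
Φ (x , y , z) = x ++ (concat (map ΦZ4 y) ++ concat (map ΦQ8 z))

ImΦ : ∀ {k1 k2 k3} → (G k1 k2 k3 → Set) → Vec Bool (len k1 k2 k3) → Set
ImΦ {k1} {k2} {k3} C v = Σ (G k1 k2 k3) λ g → C g × Φ g ≡ v

sgn : Bool → ℤ
sgn false = + 1
sgn true  = -[1+ 0 ]

ΣFin : ∀ n → (Fin n → ℤ) → ℤ
ΣFin zero    f = + 0
ΣFin (suc n) f = f Fin.zero ℤ.+ ΣFin n (λ k → f (Fin.suc k))

record IsNormHadamard (n : ℕ) (H : Fin n → Fin n → Bool) : Set where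
  field
    orth-diag : ∀ i → ΣFin n (λ k → sgn (H i k) ℤ.* sgn (H i k)) ≡ + n
    orth-off  : ∀ i j → i ≢ j → ΣFin n (λ k → sgn (H i k) ℤ.* sgn (H j k)) ≡ + 0
    norm-row  : ∀ i j → toℕ i ≡ 0 → H i j ≡ false
    norm-col  : ∀ i j → toℕ j ≡ 0 → H i j ≡ false

IsHadamardCode : ∀ {n} → (Vec Bool n → Set) → Set
IsHadamardCode {n} S =
  Σ (Fin n → Fin n → Bool) λ H → IsNormHadamard n H ×
    (∀ v → Iff (S v) (Σ (Fin n) λ i → v ≡ tabulate (H i) ⊎ v ≡ map not (tabulate (H i))))

-- Repetition of coordinates (duplication r = 2, quadruplication r = 4),
-- up to a permutation of coordinates: coordinate i of the long code is
-- coordinate f i of the short code, and every short coordinate occurs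
-- exactly r times.

Repetition : ℕ → ∀ {N n} → (Vec Bool N → Set) → (Vec Bool n → Set) → Set
Repetition r {N} {n} S D =
  Σ (Fin N → Fin n) λ f → (∀ j → HasSize (λ i → f i ≡ j) r) ×
    (∀ w → Iff (S w) (Σ (Vec Bool n) λ v → D v × w ≡ tabulate (λ i → lookup v (f i))))

-- S is a duplication of a Hadamard Z2Z4-linear code
-- (Z2^a × Z4^b is represented as G a b 0)
DuplicationOfHadamardZ2Z4 : ∀ {N} → (Vec Bool N → Set) → Set₁
DuplicationOfHadamardZ2Z4 S =
  Σ ℕ λ a → Σ ℕ λ b → Σ (G a b 0 → Set) λ D →
    IsSubgroup D × IsHadamardCode (ImΦ D) × Repetition 2 S (ImΦ D)

QuadruplicationOfHadamardZ4 : ∀ {N} → (Vec Bool N → Set) → Set₁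
QuadruplicationOfHadamardZ4 S =
  Σ ℕ λ b → Σ (G 0 b 0 → Set) λ D →
    IsSubgroup D × IsHadamardCode (ImΦ D) × Repetition 4 S (ImΦ D)

module _ {k1 k2 k3 : ℕ} (C : G k1 k2 k3 → Set) where

  data Shape : List (G k1 k2 k3) → List (G k1 k2 k3) → Set where
    shape1  : ∀ {ys} → ¬ (Σ (G k1 k2 k3) λ c → C c × sq c ≡ u) → Shape ys []
    shape1* : ∀ {ys} → (Σ (G k1 k2 k3) λ c → C c × sq c ≡ u) → Shape ys []
    shape2  : ∀ z1 z2 rest →
              sq z1 ≡ u → sq z2 ≡ u → comm z1 z2 ≡ u →
              (∀ {zj} → zj ∈ rest → comm z1 zj ≡ sq zj × comm z2 zj ≡ sq zj) →
              (∀ {zj zk} → zj ∈ rest → zk ∈ rest → comm zj zk ≡ e) →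
              Shape [] (z1 ∷ z2 ∷ rest)
    shape3  : ∀ z1 rest →
              sq z1 ≡ u → ¬ Gen (mapˡ sq rest) u →
              (∀ {zi} → zi ∈ rest → comm z1 zi ≡ sq zi) →
              (∀ {zi zj} → zi ∈ rest → zj ∈ rest → comm zi zj ≡ e) →
              Shape [] (z1 ∷ rest)
    shape4  : ∀ z1 z2 →
              sq z1 ≡ sq z2 → comm z1 z2 ≡ sq z1 → sq z1 ≢ u →
              Shape [] (z1 ∷ z2 ∷ [])
    shape4* : ∀ y1 z1 z2 →
              sq z1 ≡ sq z2 → comm z1 z2 ≡ sq z1 → sq z1 ≢ u →
              Shape (y1 ∷ []) (z1 ∷ z2 ∷ [])
    shape5  : ∀ z1 z2 z3 z4 →
              sq z1 ≡ u → sq z2 ≡ u → comm z1 z2 ≡ u →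
              sq z3 ≡ sq z4 → comm z3 z4 ≡ sq z3 → sq z3 ≢ u →
              (∀ {zi zj} → zi ∈ z1 ∷ z2 ∷ [] → zj ∈ z3 ∷ z4 ∷ [] → Gen (sq zj ∷ []) (comm zi zj)) →
              Shape [] (z1 ∷ z2 ∷ z3 ∷ z4 ∷ [])

  record NormGens : Set where
    field
      xs ys zs : List (G k1 k2 k3)
      T-gen   : T C ≐ Gen xs
      T-size  : HasSize (T C) (2 ^ length xs)
      Z-gen   : Z C ≐ Gen (xs ++ˡ ys)
      Z-size  : HasSize (Z C) (2 ^ (length xs + length ys))
      C-gen   : C ≐ Gen (xs ++ˡ ys ++ˡ zs)
      C-size  : HasSize C (2 ^ (length xs + length ys + length zs))
      shape   : Shape ys zs

-- f(z) for shape (5) needs decidable equality; we take it as a relation: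
-- F5 z z3 z4 w  means  w = f(z)
F5 : ∀ {k1 k2 k3} → G k1 k2 k3 → G k1 k2 k3 → G k1 k2 k3 → G k1 k2 k3 → Set
F5 z z3 z4 w =
  (comm z z3 ≡ e × w ≡ z3) ⊎
  (comm z z3 ≢ e × comm z z4 ≡ e × w ≡ z4) ⊎
  (comm z z3 ≢ e × comm z z4 ≢ e × w ≡ z3 · z4)

-- the standard abelian subgroup A(C) with respect to normalized generators
-- (T(C) = ⟨xs⟩ by T-gen)
stdA' : ∀ {k1 k2 k3} {C : G k1 k2 k3 → Set} (xs : List (G k1 k2 k3)) {ys zs : List (G k1 k2 k3)} →
        Shape C ys zs → G k1 k2 k3 → Set
stdA' {C = C} xs (shape1 _)  g = C g
stdA' {C = C} xs (shape1* _) g = C g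
stdA' xs (shape2 z1 z2 rest _ _ _ _ _) g = Gen (xs ++ˡ ((z1 · z2) ∷ rest)) g
stdA' xs (shape3 z1 rest _ _ _ _) g = Gen (xs ++ˡ rest) g
stdA' xs (shape4 z1 z2 _ _ _) g = Gen (xs ++ˡ (z1 ∷ [])) g
stdA' xs (shape4* y1 z1 z2 _ _ _) g = Gen (xs ++ˡ ((y1 · z1) ∷ z1 ∷ [])) g
stdA' {k1} {k2} {k3} xs (shape5 z1 z2 z3 z4 _ _ _ _ _ _ _) g =
  Σ (G k1 k2 k3) λ w → F5 z1 z3 z4 w × Gen (xs ++ˡ (z1 ∷ w ∷ [])) g

stdA : ∀ {k1 k2 k3} {C : G k1 k2 k3 → Set} → NormGens C → G k1 k2 k3 → Set
stdA ng = stdA' (NormGens.xs ng) (NormGens.shape ng)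

-- |C / A| = 2^υ  (A ≤ C, so |C| = 2^υ · |A|)
IndexIs : ∀ {k1 k2 k3} → (G k1 k2 k3 → Set) → (G k1 k2 k3 → Set) → ℕ → Set
IndexIs C A υ = Σ ℕ λ n → HasSize A n × HasSize C (2 ^ υ * n)

{-# OPTIONS --safe #-}
module Submission where

-- Write N for the length of the code and let A ≤ C be abelian, of index r, with u ∈ A. On commuting
-- elements, the i-th bit of Φ is the first Gray bit of an additive map θ i to Z4 with θ i u = 2, so
-- the columns of Φ(A) are given by characters A → Z4 with value 2 at u. Two such characters are
-- equal or have orthogonal sign vectors. Since every g ∈ A other than e and u has weight N / 2,
-- summing the product of the signs of χ g and θ i g over all g and i gives 2N; hence every χ with
-- χ u = 2 occurs among the columns exactly 2N / |A| = r times. Keeping one coordinate of Z2 for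
-- each character with χ = -χ and one coordinate of Z4 for each other pair {χ, -χ} yields a code D
-- of which Φ(A) is the r-fold repetition, and orthogonality of rows descends to D. If some z ∈ A
-- has z² = u, then no χ satisfies χ = -χ, so D is Z4-linear; this happens in shapes 2 and 5, while
-- in the other shapes C is covered by two cosets of A, so the index is not 4.

open import Defs
open import Algebra.Bundles using (Group)
open import Data.Bool using (Bool; true; false; not; _xor_; if_then_else_)
import Data.Bool.Properties as Bool
open import Data.Fin using (Fin; zero; suc; cast)
import Data.Fin.Properties as Fin
open import Data.Integer as ℤ using (ℤ; +_; -_; 0ℤ)
import Data.Integer.Properties as ℤ
open import Data.Integer.Tactic.RingSolver using (solve-∀)
open import Data.List as List using (List; []; _∷_; length; filter; allFin; deduplicate)
import Data.List.Properties as List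
open import Data.List.Membership.Propositional using (_∈_; _∉_; find; lose)
import Data.List.Membership.DecPropositional as DecMembership
open import Data.List.Membership.Propositional.Properties
  using (∈-filter⁺; ∈-filter⁻; ∈-allFin; ∈-deduplicate⁺; ∈-map⁺; ∈-map⁻; ∈-++⁺ˡ; ∈-++⁺ʳ; ∈-++⁻; ∈-lookup)
open import Data.List.Membership.Propositional.Properties.WithK using (unique∧set⇒bag)
open import Data.List.Relation.Binary.BagAndSetEquality using (∼bag⇒↭)
open import Data.List.Relation.Binary.Permutation.Propositional as Perm using (_↭_)
open import Data.List.Relation.Binary.Permutation.Propositional.Properties using (↭-length)
open import Data.List.Relation.Unary.All as All using ([]; _∷_)
import Data.List.Relation.Unary.All.Properties as All
open import Data.List.Relation.Unary.AllPairs using ([]; _∷_)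
open import Data.List.Relation.Unary.Any as Any using (here; there)
open import Data.List.Relation.Unary.Any.Properties using (lookup-index)
open import Data.List.Relation.Unary.Unique.Propositional using (Unique)
import Data.List.Relation.Unary.Unique.DecPropositional.Properties as DecUnique
import Data.List.Relation.Unary.Unique.Propositional.Properties as Unique
open import Data.Nat as ℕ using (ℕ; zero; suc; _^_)
import Data.Nat.Properties as ℕ
open import Data.Product using (Σ; _×_; _,_; proj₁; proj₂)
import Data.Product.Properties as Product
open import Data.Sum as Sum using (_⊎_; inj₁; inj₂; [_,_]′)
open import Data.Vec as Vec using (Vec; []; _∷_)
import Data.Vec.Properties as Vec
open import Data.Vec.Relation.Unary.All as VAll using ([]; _∷_)
import Data.Vec.Relation.Unary.All.Properties as VAll
open import Data.Vec.Relation.Unary.AllPairs using (AllPairs; []; _∷_)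
import Data.Vec.Relation.Unary.AllPairs.Properties as VAllPairs
open import Data.Vec.Relation.Unary.Any as VAny using (here; there)
import Data.Vec.Relation.Unary.Any.Properties as VAny
import Data.Vec.Relation.Unary.Unique.Setoid.Properties as VUnique
open import Function using (_∘_; mk⇔)
open import Level using (0ℓ)
open import Relation.Binary using (DecidableEquality; DecSetoid)
open import Relation.Binary.PropositionalEquality
open import Relation.Nullary using (Dec; yes; no; ¬_; does; contradiction)
open import Relation.Nullary.Decidable
  using (True; toWitness; map′; _×-dec_; _→-dec_; ¬?; decidable-stable)
open import Relation.Unary using (Decidable)

-- The group Z2^k1 × Z4^k2 × Q8^k3

-- The Gray map is not a homomorphism, and inside a Q8 block no fixed pairing of coordinates serves
-- all elements. The way out is to pair the bit at g with the bit of the same coordinate at g^-1: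
-- for x in Z4 the two Gray bits of x are exactly the first bits of x and -x. Each single coordinate
-- thus becomes a character of A, and its Gray partner is a coordinate carrying -χ. No block has to
-- be inspected to find that partner: the double count gives the same multiplicity to every
-- character with value 2 at u, whether or not it was known to be a coordinate, so -χ occurs as
-- often as χ. All sums are sums of integers, and they vanish because some translation of A negates
-- the summand. Finally, a Hadamard code of length N has 2N words, so index r means 2N = r|A|; this
-- equation makes the multiplicity equal to r and gives the short code the right size.

infix 4 _≟₄_ _≟₈_ _≟G_

_≟₄_ : DecidableEquality Z4
c0 ≟₄ c0 = yes refl
c0 ≟₄ c1 = no λ ()
c0 ≟₄ c2 = no λ ()
c0 ≟₄ c3 = no λ ()
c1 ≟₄ c0 = no λ ()
c1 ≟₄ c1 = yes refl
c1 ≟₄ c2 = no λ ()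
c1 ≟₄ c3 = no λ ()
c2 ≟₄ c0 = no λ ()
c2 ≟₄ c1 = no λ ()
c2 ≟₄ c2 = yes refl
c2 ≟₄ c3 = no λ ()
c3 ≟₄ c0 = no λ ()
c3 ≟₄ c1 = no λ ()
c3 ≟₄ c2 = no λ ()
c3 ≟₄ c3 = yes refl

_≟₈_ : DecidableEquality Q8
q8 i b ≟₈ q8 j c =
  map′ (λ { (refl , refl) → refl }) (λ { refl → refl , refl }) (i ≟₄ j ×-dec b Bool.≟ c)

_≟G_ : ∀ {k1 k2 k3} → DecidableEquality (G k1 k2 k3)
_≟G_ = Product.≡-dec (Vec.≡-dec Bool._≟_) (Product.≡-dec (Vec.≡-dec _≟₄_) (Vec.≡-dec _≟₈_))

-- Identities over the finite factors are proved by exhaustive evaluation: the implicit argument is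
-- solved exactly when the decision procedure answers yes.
decide : {A : Set} (A? : Dec A) {_ : True A?} → A
decide A? {p} = toWitness p

∀₂? : {P : Bool → Set} → (∀ x → Dec (P x)) → Dec (∀ x → P x)
∀₂? P? = map′ (λ { (p , q) false → p ; (p , q) true → q }) (λ p → p false , p true)
  (P? false ×-dec P? true)

∀₄? : {P : Z4 → Set} → (∀ x → Dec (P x)) → Dec (∀ x → P x)
∀₄? P? = map′
  (λ { (p , _) c0 → p ; (_ , p , _) c1 → p ; (_ , _ , p , _) c2 → p ; (_ , _ , _ , p) c3 → p })
  (λ p → p c0 , p c1 , p c2 , p c3)
  (P? c0 ×-dec P? c1 ×-dec P? c2 ×-dec P? c3)

∀₈? : {P : Q8 → Set} → (∀ x → Dec (P x)) → Dec (∀ x → P x)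
∀₈? P? = map′ (λ p x → p (Q8.apow x) (Q8.bpow x)) (λ p i b → p (q8 i b))
  (∀₄? λ i → ∀₂? λ b → P? (q8 i b))

module _ {A : Set} {_•_ : A → A → A} where

  private
    _⊛_ : ∀ {n} → Vec A n → Vec A n → Vec A n
    _⊛_ = Vec.zipWith _•_

  square-central : (∀ x y → (x • x) • y ≡ y • (x • x)) →
                   ∀ {n} (xs ys : Vec A n) → (xs ⊛ xs) ⊛ ys ≡ ys ⊛ (xs ⊛ xs)
  square-central p []       []       = refl
  square-central p (x ∷ xs) (y ∷ ys) = cong₂ _∷_ (p x y) (square-central p xs ys)

  square-square : ∀ {ε} → (∀ x → (x • x) • (x • x) ≡ ε) →
                  ∀ {n} (xs : Vec A n) → (xs ⊛ xs) ⊛ (xs ⊛ xs) ≡ Vec.replicate n ε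
  square-square p []       = refl
  square-square p (x ∷ xs) = cong₂ _∷_ (p x) (square-square p xs)

module _ {k1 k2 k3 : ℕ} where

  private
    Γ = G k1 k2 k3

  triple-≡ : {x x' : Vec Bool k1} {y y' : Vec Z4 k2} {z z' : Vec Q8 k3} →
             x ≡ x' → y ≡ y' → z ≡ z' → _≡_ {A = Γ} (x , y , z) (x' , y' , z')
  triple-≡ refl refl refl = refl

  ·-assoc : (g h k : Γ) → (g · h) · k ≡ g · (h · k)
  ·-assoc (x , y , z) (x' , y' , z') (x'' , y'' , z'') = triple-≡
    (Vec.zipWith-assoc Bool.xor-assoc x x' x'')
    (Vec.zipWith-assoc
      (decide (∀₄? λ a → ∀₄? λ b → ∀₄? λ c → add4 (add4 a b) c ≟₄ add4 a (add4 b c))) y y' y'')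
    (Vec.zipWith-assoc
      (decide (∀₈? λ a → ∀₈? λ b → ∀₈? λ c → q8mul (q8mul a b) c ≟₈ q8mul a (q8mul b c))) z z' z'')

  ·-identityˡ : (g : Γ) → e · g ≡ g
  ·-identityˡ (x , y , z) = triple-≡
    (Vec.zipWith-identityˡ Bool.xor-identityˡ x)
    (Vec.zipWith-identityˡ (λ _ → refl) y)
    (Vec.zipWith-identityˡ (λ _ → refl) z)

  ·-identityʳ : (g : Γ) → g · e ≡ g
  ·-identityʳ (x , y , z) = triple-≡
    (Vec.zipWith-identityʳ Bool.xor-identityʳ x)
    (Vec.zipWith-identityʳ (decide (∀₄? λ a → add4 a c0 ≟₄ a)) y)
    (Vec.zipWith-identityʳ (decide (∀₈? λ a → q8mul a (q8 c0 false) ≟₈ a)) z)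

  ·-inverseˡ : (g : Γ) → (g ⁻¹) · g ≡ e
  ·-inverseˡ (x , y , z) = triple-≡
    (trans (cong (λ v → Vec.zipWith _xor_ v x) (sym (Vec.map-id x)))
           (Vec.zipWith-inverseˡ {⁻¹ = λ b → b} Bool.xor-same x))
    (Vec.zipWith-inverseˡ (decide (∀₄? λ a → add4 (neg4 a) a ≟₄ c0)) y)
    (Vec.zipWith-inverseˡ (decide (∀₈? λ a → q8mul (q8inv a) a ≟₈ q8 c0 false)) z)

  ·-inverseʳ : (g : Γ) → g · (g ⁻¹) ≡ e
  ·-inverseʳ (x , y , z) = triple-≡
    (trans (cong (Vec.zipWith _xor_ x) (sym (Vec.map-id x)))
           (Vec.zipWith-inverseʳ {⁻¹ = λ b → b} Bool.xor-same x))
    (Vec.zipWith-inverseʳ (decide (∀₄? λ a → add4 a (neg4 a) ≟₄ c0)) y)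
    (Vec.zipWith-inverseʳ (decide (∀₈? λ a → q8mul a (q8inv a) ≟₈ q8 c0 false)) z)

  -- The squares in Q8 are 1 and a^2, which form its center. Since every commutator in the shapes is
  -- e or a square, commutators can later be moved freely through products.
  sq-central : (g h : Γ) → sq g · h ≡ h · sq g
  sq-central (x , y , z) (x' , y' , z') = triple-≡
    (square-central (decide (∀₂? λ a → ∀₂? λ b → (a xor a) xor b Bool.≟ b xor (a xor a))) x x')
    (square-central
      (decide (∀₄? λ a → ∀₄? λ b → add4 (add4 a a) b ≟₄ add4 b (add4 a a))) y y')
    (square-central
      (decide (∀₈? λ a → ∀₈? λ b → q8mul (q8mul a a) b ≟₈ q8mul b (q8mul a a))) z z')

  sq-sq : (g : Γ) → sq (sq g) ≡ e
  sq-sq (x , y , z) = triple-≡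
    (square-square (decide (∀₂? λ a → (a xor a) xor (a xor a) Bool.≟ false)) x)
    (square-square (decide (∀₄? λ a → add4 (add4 a a) (add4 a a) ≟₄ c0)) y)
    (square-square (decide (∀₈? λ a → q8mul (q8mul a a) (q8mul a a) ≟₈ q8 c0 false)) z)

  sq-u : sq (u {k1} {k2} {k3}) ≡ e
  sq-u = triple-≡ (Vec.zipWith-replicate _ _ _) (Vec.zipWith-replicate _ _ _) (Vec.zipWith-replicate _ _ _)

G-group : ℕ → ℕ → ℕ → Group 0ℓ 0ℓ
G-group k1 k2 k3 = record
  { Carrier = G k1 k2 k3 ; _≈_ = _≡_ ; _∙_ = _·_ ; ε = e ; _⁻¹ = _⁻¹
  ; isGroup = record
    { isMonoid = record
      { isSemigroup = record
        { isMagma = record { isEquivalence = isEquivalence ; ∙-cong = cong₂ _·_ }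
        ; assoc = ·-assoc }
      ; identity = ·-identityˡ , ·-identityʳ }
    ; inverse = ·-inverseˡ , ·-inverseʳ
    ; ⁻¹-cong = cong _⁻¹ } }

-- The Gray map

bit : Z4 → Bool
bit c0 = false
bit c1 = false
bit c2 = true
bit c3 = true

-- The inverse of `ΦZ4`. The Gray bits of x are `bit x` and `bit (neg4 x)`, so x is recovered from
-- the first bits of x and of its inverse.
ungray : Bool → Bool → Z4
ungray false false = c0
ungray false true  = c1
ungray true  true  = c2
ungray true  false = c3

bit-ungray : ∀ a b → bit (ungray a b) ≡ a
bit-ungray = decide (∀₂? λ a → ∀₂? λ b → bit (ungray a b) Bool.≟ a)

++-replicate : ∀ {A : Set} (k : ℕ) {l : ℕ} {x : A} →
               Vec.replicate k x Vec.++ Vec.replicate l x ≡ Vec.replicate (k ℕ.+ l) x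
++-replicate zero        = refl
++-replicate (suc k) {x = x} = cong (x ∷_) (++-replicate k)

module Blocks {B : Set} {m : ℕ} (φ : B → Vec Bool m) where

  blocks : ∀ {n} → Vec B n → Vec Bool (n ℕ.* m)
  blocks xs = Vec.concat (Vec.map φ xs)

  blocks-injective : (∀ x y → φ x ≡ φ y → x ≡ y) →
                     ∀ {n} (xs ys : Vec B n) → blocks xs ≡ blocks ys → xs ≡ ys
  blocks-injective inj []       []       _  = refl
  blocks-injective inj (x ∷ xs) (y ∷ ys) eq =
    let p , q = Vec.++-injective (φ x) (φ y) eq
    in cong₂ _∷_ (inj x y p) (blocks-injective inj xs ys q)

  blocks-replicate : ∀ {ε b} → φ ε ≡ Vec.replicate m b →
                     ∀ n → blocks (Vec.replicate n ε) ≡ Vec.replicate (n ℕ.* m) b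
  blocks-replicate p zero    = refl
  blocks-replicate {b = b} p (suc n) =
    trans (cong₂ Vec._++_ p (blocks-replicate p n)) (++-replicate m)
  blocks-map : {f : B → B} {h : Bool → Bool} → (∀ x → φ (f x) ≡ Vec.map h (φ x)) →
               ∀ {n} (xs : Vec B n) → blocks (Vec.map f xs) ≡ Vec.map h (blocks xs)
  blocks-map p []       = refl
  blocks-map p (x ∷ xs) =
    trans (cong₂ Vec._++_ (p x) (blocks-map p xs)) (sym (Vec.map-++ _ (φ x) (blocks xs)))

  module _ (_•_ : B → B → B) (inv : B → B)
           (additive : ∀ x y → x • y ≡ y • x →
             Vec.zipWith ungray (φ (x • y)) (φ (inv (x • y))) ≡
             Vec.zipWith add4 (Vec.zipWith ungray (φ x) (φ (inv x)))
                              (Vec.zipWith ungray (φ y) (φ (inv y)))) where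

    ungrayed : ∀ {n} → Vec B n → Vec Z4 (n ℕ.* m)
    ungrayed xs = Vec.zipWith ungray (blocks xs) (blocks (Vec.map inv xs))

    -- Commuting vectors commute entry by entry, so the hypothesis on single blocks applies to each
    -- block in turn. The rewrites distribute `zipWith` over the block boundary.
    ungrayed-additive : ∀ {n} (xs ys : Vec B n) →
      Vec.zipWith _•_ xs ys ≡ Vec.zipWith _•_ ys xs →
      ungrayed (Vec.zipWith _•_ xs ys) ≡ Vec.zipWith add4 (ungrayed xs) (ungrayed ys)
    ungrayed-additive []       []       _ = refl
    ungrayed-additive (x ∷ xs) (y ∷ ys) c
      rewrite Vec.zipWith-++ ungray (φ (x • y)) (blocks (Vec.zipWith _•_ xs ys))
                (φ (inv (x • y))) (blocks (Vec.map inv (Vec.zipWith _•_ xs ys)))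
            | Vec.zipWith-++ ungray (φ x) (blocks xs) (φ (inv x)) (blocks (Vec.map inv xs))
            | Vec.zipWith-++ ungray (φ y) (blocks ys) (φ (inv y)) (blocks (Vec.map inv ys))
            | Vec.zipWith-++ add4 (Vec.zipWith ungray (φ x) (φ (inv x))) (ungrayed xs)
                (Vec.zipWith ungray (φ y) (φ (inv y))) (ungrayed ys)
      = cong₂ Vec._++_ (additive x y (Vec.∷-injectiveˡ c)) (ungrayed-additive xs ys (Vec.∷-injectiveʳ c))

module _ {k1 k2 k3 : ℕ} where

  private
    Γ = G k1 k2 k3
    module B₄ = Blocks ΦZ4
    module B₈ = Blocks ΦQ8

  Φ-injective : (g h : Γ) → Φ g ≡ Φ h → g ≡ h
  Φ-injective (x , y , z) (x' , y' , z') eq =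
    let p , r = Vec.++-injective x x' eq
        q , s = Vec.++-injective (B₄.blocks y) (B₄.blocks y') r
    in triple-≡ p
         (B₄.blocks-injective
           (decide (∀₄? λ a → ∀₄? λ b → Vec.≡-dec Bool._≟_ (ΦZ4 a) (ΦZ4 b) →-dec (a ≟₄ b))) y y' q)
         (B₈.blocks-injective
           (decide (∀₈? λ a → ∀₈? λ b → Vec.≡-dec Bool._≟_ (ΦQ8 a) (ΦQ8 b) →-dec (a ≟₈ b))) z z' s)

  Φ-e : Φ (e {k1} {k2} {k3}) ≡ Vec.replicate _ false
  Φ-e = trans (cong (Vec.replicate k1 false Vec.++_)
                (trans (cong₂ Vec._++_ (B₄.blocks-replicate refl k2) (B₈.blocks-replicate refl k3))
                       (++-replicate (k2 ℕ.* 2))))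
              (++-replicate k1)
  -- Turns complementation of codewords, under which Hadamard codes are closed, into multiplication
  -- inside the group.
  Φ-u· : (g : Γ) → Φ (u · g) ≡ Vec.map not (Φ g)
  Φ-u· (x , y , z) = begin
    Φ (u · (x , y , z))
      ≡⟨ cong₂ Vec._++_ (Vec.zipWith-replicate₁ _xor_ true x) (cong₂ Vec._++_
           (cong B₄.blocks (Vec.zipWith-replicate₁ add4 c2 y))
           (cong B₈.blocks (Vec.zipWith-replicate₁ q8mul (q8 c2 false) z))) ⟩
    Vec.map not x Vec.++
      (B₄.blocks (Vec.map (add4 c2) y) Vec.++ B₈.blocks (Vec.map (q8mul (q8 c2 false)) z))
      ≡⟨ cong (Vec.map not x Vec.++_) (cong₂ Vec._++_ (B₄.blocks-map complement₄ y) (B₈.blocks-map complement₈ z)) ⟩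
    Vec.map not x Vec.++ (Vec.map not (B₄.blocks y) Vec.++ Vec.map not (B₈.blocks z))
      ≡⟨ cong (Vec.map not x Vec.++_) (Vec.map-++ not (B₄.blocks y) (B₈.blocks z)) ⟨
    Vec.map not x Vec.++ Vec.map not (B₄.blocks y Vec.++ B₈.blocks z)
      ≡⟨ Vec.map-++ not x (B₄.blocks y Vec.++ B₈.blocks z) ⟨
    Vec.map not (Φ (x , y , z)) ∎
    where
    open ≡-Reasoning
    complement₄ : ∀ a → ΦZ4 (add4 c2 a) ≡ Vec.map not (ΦZ4 a)
    complement₄ = decide (∀₄? λ a → Vec.≡-dec Bool._≟_ _ _)
    complement₈ : ∀ a → ΦQ8 (q8mul (q8 c2 false) a) ≡ Vec.map not (ΦQ8 a)
    complement₈ = decide (∀₈? λ a → Vec.≡-dec Bool._≟_ _ _)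

  -- Using the same coordinate at g and at g^-1 avoids choosing a partner coordinate, which in a Q8
  -- block would depend on g. On a coordinate of Z2 the two bits agree, so only the values 0 and 2
  -- arise there.
  θ : Fin (len k1 k2 k3) → Γ → Z4
  θ i g = ungray (Vec.lookup (Φ g) i) (Vec.lookup (Φ (g ⁻¹)) i)

  private
    Θ : Γ → Vec Z4 (len k1 k2 k3)
    Θ g = Vec.zipWith ungray (Φ g) (Φ (g ⁻¹))

    xor-additive : ∀ {n} (xs ys : Vec Bool n) →
      Vec.zipWith ungray (Vec.zipWith _xor_ xs ys) (Vec.zipWith _xor_ xs ys) ≡
      Vec.zipWith add4 (Vec.zipWith ungray xs xs) (Vec.zipWith ungray ys ys)
    xor-additive []       []       = refl
    xor-additive (x ∷ xs) (y ∷ ys) = cong₂ _∷_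
      (decide (∀₂? λ a → ∀₂? λ b →
        ungray (a xor b) (a xor b) ≟₄ add4 (ungray a a) (ungray b b)) x y)
      (xor-additive xs ys)

    additive₄ : ∀ x y → add4 x y ≡ add4 y x →
      Vec.zipWith ungray (ΦZ4 (add4 x y)) (ΦZ4 (neg4 (add4 x y))) ≡
      Vec.zipWith add4 (Vec.zipWith ungray (ΦZ4 x) (ΦZ4 (neg4 x)))
                       (Vec.zipWith ungray (ΦZ4 y) (ΦZ4 (neg4 y)))
    additive₄ = decide (∀₄? λ x → ∀₄? λ y → (add4 x y ≟₄ add4 y x) →-dec Vec.≡-dec _≟₄_ _ _)

    additive₈ : ∀ x y → q8mul x y ≡ q8mul y x →
      Vec.zipWith ungray (ΦQ8 (q8mul x y)) (ΦQ8 (q8inv (q8mul x y))) ≡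
      Vec.zipWith add4 (Vec.zipWith ungray (ΦQ8 x) (ΦQ8 (q8inv x)))
                       (Vec.zipWith ungray (ΦQ8 y) (ΦQ8 (q8inv y)))
    additive₈ = decide (∀₈? λ x → ∀₈? λ y → (q8mul x y ≟₈ q8mul y x) →-dec Vec.≡-dec _≟₄_ _ _)

    Θ-split : (g : Γ) → let x , y , z = g in
      Θ g ≡ Vec.zipWith ungray x x Vec.++
            (B₄.ungrayed add4 neg4 additive₄ y Vec.++ B₈.ungrayed q8mul q8inv additive₈ z)
    Θ-split (x , y , z)
      rewrite Vec.zipWith-++ ungray x (B₄.blocks y Vec.++ B₈.blocks z)
                x (B₄.blocks (Vec.map neg4 y) Vec.++ B₈.blocks (Vec.map q8inv z))
            | Vec.zipWith-++ ungray (B₄.blocks y) (B₈.blocks z)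
                (B₄.blocks (Vec.map neg4 y)) (B₈.blocks (Vec.map q8inv z))
      = refl

    Θ-additive : (g h : Γ) → g · h ≡ h · g → Θ (g · h) ≡ Vec.zipWith add4 (Θ g) (Θ h)
    Θ-additive g@(x , y , z) h@(x' , y' , z') c
      rewrite Θ-split (g · h) | Θ-split g | Θ-split h
            | Vec.zipWith-++ add4 (Vec.zipWith ungray x x)
                (B₄.ungrayed add4 neg4 additive₄ y Vec.++ B₈.ungrayed q8mul q8inv additive₈ z)
                (Vec.zipWith ungray x' x')
                (B₄.ungrayed add4 neg4 additive₄ y' Vec.++ B₈.ungrayed q8mul q8inv additive₈ z')
            | Vec.zipWith-++ add4 (B₄.ungrayed add4 neg4 additive₄ y) (B₈.ungrayed q8mul q8inv additive₈ z)
                (B₄.ungrayed add4 neg4 additive₄ y') (B₈.ungrayed q8mul q8inv additive₈ z')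
      = cong₂ Vec._++_ (xor-additive x x') (cong₂ Vec._++_
          (B₄.ungrayed-additive add4 neg4 additive₄ y y' (cong (proj₁ ∘ proj₂) c))
          (B₈.ungrayed-additive q8mul q8inv additive₈ z z' (cong (proj₂ ∘ proj₂) c)))

  bit-θ : ∀ i (g : Γ) → bit (θ i g) ≡ Vec.lookup (Φ g) i
  bit-θ i g = bit-ungray (Vec.lookup (Φ g) i) (Vec.lookup (Φ (g ⁻¹)) i)

  -- On Q8 this is false for non-commuting pairs: Φ restricted to a cyclic subgroup ⟨q⟩ of order 4
  -- is the Gray map of Z4 with each bit written twice, but the bits paired depend on ⟨q⟩.
  θ-additive : ∀ i (g h : Γ) → g · h ≡ h · g → θ i (g · h) ≡ add4 (θ i g) (θ i h)
  θ-additive i g h c = begin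
    θ i (g · h)                                        ≡⟨ Vec.lookup-zipWith ungray i (Φ (g · h)) (Φ ((g · h) ⁻¹)) ⟨
    Vec.lookup (Θ (g · h)) i                           ≡⟨ cong (λ v → Vec.lookup v i) (Θ-additive g h c) ⟩
    Vec.lookup (Vec.zipWith add4 (Θ g) (Θ h)) i        ≡⟨ Vec.lookup-zipWith add4 i (Θ g) (Θ h) ⟩
    add4 (Vec.lookup (Θ g) i) (Vec.lookup (Θ h) i)     ≡⟨ cong₂ add4 (Vec.lookup-zipWith ungray i (Φ g) (Φ (g ⁻¹)))
                                                                     (Vec.lookup-zipWith ungray i (Φ h) (Φ (h ⁻¹))) ⟩
    add4 (θ i g) (θ i h)                               ∎
    where open ≡-Reasoning

  θ-u : ∀ i → θ i u ≡ c2
  θ-u i = cong₂ ungray Φu (trans (cong (λ g → Vec.lookup (Φ g) i) u⁻¹) Φu)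
    where
    u⁻¹ : u {k1} {k2} {k3} ⁻¹ ≡ u
    u⁻¹ = triple-≡ refl (Vec.map-replicate neg4 c2 k2) (Vec.map-replicate q8inv (q8 c2 false) k3)

    Φ-u : Φ (u {k1} {k2} {k3}) ≡ Vec.map not (Vec.replicate _ false)
    Φ-u = trans (cong (Φ {k1} {k2} {k3}) (sym (·-identityʳ u))) (trans (Φ-u· e) (cong (Vec.map not) Φ-e))

    Φu : Vec.lookup (Φ (u {k1} {k2} {k3})) i ≡ true
    Φu = begin
      Vec.lookup (Φ (u {k1} {k2} {k3})) i                    ≡⟨ cong (λ v → Vec.lookup v i) Φ-u ⟩
      Vec.lookup (Vec.map not (Vec.replicate _ false)) i     ≡⟨ Vec.lookup-map i not (Vec.replicate _ false) ⟩
      not (Vec.lookup (Vec.replicate _ false) i)             ≡⟨ cong not (Vec.lookup-replicate i false) ⟩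
      true                                                   ∎
      where open ≡-Reasoning

-- Finite sums

module _ {A : Set} where

  same-elements⇒↭ : {l m : List A} → Unique l → Unique m →
                    (∀ {x} → x ∈ l → x ∈ m) → (∀ {x} → x ∈ m → x ∈ l) → l ↭ m
  same-elements⇒↭ l! m! l⊆m m⊆l = ∼bag⇒↭ (unique∧set⇒bag l! m! (mk⇔ l⊆m m⊆l))

  same-elements⇒length : {l m : List A} → Unique l → Unique m →
                         (∀ {x} → x ∈ l → x ∈ m) → (∀ {x} → x ∈ m → x ∈ l) → length l ≡ length m
  same-elements⇒length l! m! l⊆m m⊆l = ↭-length (same-elements⇒↭ l! m! l⊆m m⊆l)

  -- Removing repetitions from `m` and keeping only entries of `l` leaves a list with the same
  -- elements as `l`, and neither operation lengthens `m`.
  unique-⊆⇒length-≤ : DecidableEquality A → {l m : List A} → Unique l →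
                      (∀ {x} → x ∈ l → x ∈ m) → length l ℕ.≤ length m
  unique-⊆⇒length-≤ _≟_ {l} {m} l! l⊆m = begin
    length l          ≡⟨ same-elements⇒length l! m'! (λ x∈l → ∈-filter⁺ (_∈? l) (∈-deduplicate⁺ _≟_ (l⊆m x∈l)) x∈l)
                           (λ x∈m' → proj₂ (∈-filter⁻ (_∈? l) {xs = deduplicate _≟_ m} x∈m')) ⟩
    length m'         ≤⟨ List.length-filter (_∈? l) (deduplicate _≟_ m) ⟩
    length (deduplicate _≟_ m) ≤⟨ List.length-deduplicate _≟_ m ⟩
    length m          ∎
    where
    open ℕ.≤-Reasoning
    open DecMembership _≟_ using (_∈?_)
    m' = filter (_∈? l) (deduplicate _≟_ m)
    m'! : Unique m'
    m'! = Unique.filter⁺ (_∈? l) (DecUnique.deduplicate-! _≟_ m)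

  HasSize-unique : {P : A → Set} {m n : ℕ} → HasSize P m → HasSize P n → m ≡ n
  HasSize-unique (l , l! , refl , P⇔l) (k , k! , refl , P⇔k) = same-elements⇒length l! k!
    (λ {x} x∈l → proj₁ (P⇔k x) (proj₂ (P⇔l x) x∈l)) (λ {x} x∈k → proj₁ (P⇔l x) (proj₂ (P⇔k x) x∈k))

  ∑ : List A → (A → ℤ) → ℤ
  ∑ []      f = 0ℤ
  ∑ (x ∷ l) f = f x ℤ.+ ∑ l f

  ∑-cong : ∀ l {f g : A → ℤ} → (∀ {x} → x ∈ l → f x ≡ g x) → ∑ l f ≡ ∑ l g
  ∑-cong []      p = refl
  ∑-cong (x ∷ l) p = cong₂ ℤ._+_ (p (here refl)) (∑-cong l (p ∘ there))

  ∑-zero : ∀ l {f : A → ℤ} → (∀ {x} → x ∈ l → f x ≡ 0ℤ) → ∑ l f ≡ 0ℤ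
  ∑-zero []      p = refl
  ∑-zero (x ∷ l) p = cong₂ ℤ._+_ (p (here refl)) (∑-zero l (p ∘ there))

  ∑-+ : ∀ l (f g : A → ℤ) → ∑ l (λ x → f x ℤ.+ g x) ≡ ∑ l f ℤ.+ ∑ l g
  ∑-+ []      f g = refl
  ∑-+ (x ∷ l) f g = trans (cong (ℤ._+_ ((f x ℤ.+ g x))) (∑-+ l f g)) (interchange (f x) (g x) (∑ l f) (∑ l g))
    where
    interchange : ∀ a b c d → (a ℤ.+ b) ℤ.+ (c ℤ.+ d) ≡ (a ℤ.+ c) ℤ.+ (b ℤ.+ d)
    interchange = solve-∀

  ∑-*ˡ : ∀ l c (f : A → ℤ) → ∑ l (λ x → c ℤ.* f x) ≡ c ℤ.* ∑ l f
  ∑-*ˡ []      c f = sym (ℤ.*-zeroʳ c)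
  ∑-*ˡ (x ∷ l) c f = trans (cong (ℤ._+_ (c ℤ.* f x)) (∑-*ˡ l c f)) (sym (ℤ.*-distribˡ-+ c (f x) (∑ l f)))

  ∑-neg : ∀ l (f : A → ℤ) → ∑ l (λ x → - f x) ≡ - ∑ l f
  ∑-neg []      f = refl
  ∑-neg (x ∷ l) f = trans (cong (ℤ._+_ (- f x)) (∑-neg l f)) (sym (ℤ.neg-distrib-+ (f x) (∑ l f)))

  ∑-const : ∀ (l : List A) c → ∑ l (λ _ → c) ≡ + length l ℤ.* c
  ∑-const []      c = refl
  ∑-const (x ∷ l) c = trans (cong (ℤ._+_ (c)) (∑-const l c)) (sym (ℤ.suc-* (+ length l) c))

  ∑-↭ : ∀ {l m} (f : A → ℤ) → l ↭ m → ∑ l f ≡ ∑ m f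
  ∑-↭ f Perm.refl         = refl
  ∑-↭ f (Perm.prep x p)   = cong (ℤ._+_ (f x)) (∑-↭ f p)
  ∑-↭ f (Perm.swap {xs} {ys} x y p) = trans (cong (λ s → f x ℤ.+ (f y ℤ.+ s)) (∑-↭ f p)) (exchange (f x) (f y) (∑ ys f))
    where
    exchange : ∀ a b c → a ℤ.+ (b ℤ.+ c) ≡ b ℤ.+ (a ℤ.+ c)
    exchange = solve-∀
  ∑-↭ f (Perm.trans p q)  = trans (∑-↭ f p) (∑-↭ f q)

  ∑-filter : ∀ {P : A → Set} (P? : Decidable P) l (f : A → ℤ) →
             ∑ l (λ x → if does (P? x) then f x else 0ℤ) ≡ ∑ (filter P? l) f
  ∑-filter P? []      f = refl
  ∑-filter P? (x ∷ l) f with does (P? x)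
  ... | true  = cong (ℤ._+_ (f x)) (∑-filter P? l f)
  ... | false = trans (ℤ.+-identityˡ _) (∑-filter P? l f)

module _ {A B : Set} where

  ∑-map : ∀ (h : A → B) l (f : B → ℤ) → ∑ (List.map h l) f ≡ ∑ l (f ∘ h)
  ∑-map h []      f = refl
  ∑-map h (x ∷ l) f = cong (ℤ._+_ (f (h x))) (∑-map h l f)

  ∑-swap : ∀ l m (f : A → B → ℤ) → ∑ l (λ x → ∑ m (f x)) ≡ ∑ m (λ y → ∑ l (λ x → f x y))
  ∑-swap []      m f = sym (∑-zero m λ _ → refl)
  ∑-swap (x ∷ l) m f = trans (cong (ℤ._+_ (∑ m (f x))) (∑-swap l m f)) (sym (∑-+ m (f x) (λ y → ∑ l (λ x → f x y))))

∑ᶠ : ∀ n → (Fin n → ℤ) → ℤ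
∑ᶠ n = ∑ (allFin n)

ΣFin≡∑ᶠ : ∀ n (f : Fin n → ℤ) → ΣFin n f ≡ ∑ᶠ n f
ΣFin≡∑ᶠ n f = ΣFin≡∑ n (λ i → i)
  where
  ΣFin≡∑ : ∀ k (g : Fin k → Fin n) → ΣFin k (f ∘ g) ≡ ∑ (List.tabulate g) f
  ΣFin≡∑ zero    g = refl
  ΣFin≡∑ (suc k) g = cong (ℤ._+_ (f (g zero))) (ΣFin≡∑ k (g ∘ suc))

∑ᶠ-const : ∀ n c → ∑ᶠ n (λ _ → c) ≡ + n ℤ.* c
∑ᶠ-const n c = trans (∑-const (allFin n) c) (cong (λ k → + k ℤ.* c) (List.length-tabulate {n = n} (λ i → i)))

length-fibre : ∀ {N n r} {f : Fin N → Fin n} (j : Fin n) → HasSize (λ i → f i ≡ j) r →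
               length (filter (λ i → f i Fin.≟ j) (allFin N)) ≡ r
length-fibre {N} {f = f} j size = HasSize-unique
  ( filter (λ i → f i Fin.≟ j) (allFin N) , Unique.filter⁺ _ (Unique.allFin⁺ N) , refl
  , λ i → (λ p → ∈-filter⁺ _ (∈-allFin i) p) , (λ p → proj₂ (∈-filter⁻ (λ i → f i Fin.≟ j) {xs = allFin N} p)) )
  size

-- Insert the indicator of f i = j and exchange the two sums: each fibre then contributes r equal
-- terms.
∑ᶠ-repetition : ∀ {N n r} (f : Fin N → Fin n) → (∀ j → HasSize (λ i → f i ≡ j) r) →
                (F : Fin n → ℤ) → ∑ᶠ N (F ∘ f) ≡ + r ℤ.* ∑ᶠ n F
∑ᶠ-repetition {N} {n} {r} f size F = begin
  ∑ᶠ N (F ∘ f)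
    ≡⟨ ∑-cong (allFin N) (λ {i} _ → sym (point i)) ⟩
  ∑ᶠ N (λ i → ∑ᶠ n (λ j → if does (f i Fin.≟ j) then F j else 0ℤ))
    ≡⟨ ∑-swap (allFin N) (allFin n) _ ⟩
  ∑ᶠ n (λ j → ∑ᶠ N (λ i → if does (f i Fin.≟ j) then F j else 0ℤ))
    ≡⟨ ∑-cong (allFin n) (λ {j} _ → fibre j) ⟩
  ∑ᶠ n (λ j → + r ℤ.* F j)
    ≡⟨ ∑-*ˡ (allFin n) (+ r) F ⟩
  + r ℤ.* ∑ᶠ n F ∎
  where
  open ≡-Reasoning
  point : ∀ i → ∑ᶠ n (λ j → if does (f i Fin.≟ j) then F j else 0ℤ) ≡ F (f i)
  point i = begin
    ∑ᶠ n (λ j → if does (f i Fin.≟ j) then F j else 0ℤ) ≡⟨ ∑-filter (f i Fin.≟_) (allFin n) F ⟩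
    ∑ (filter (f i Fin.≟_) (allFin n)) F
      ≡⟨ ∑-↭ F (same-elements⇒↭ (Unique.filter⁺ (f i Fin.≟_) (Unique.allFin⁺ n)) ([] ∷ [])
           (λ p → here (sym (proj₂ (∈-filter⁻ (f i Fin.≟_) {xs = allFin n} p))))
           (λ { (here refl) → ∈-filter⁺ (f i Fin.≟_) (∈-allFin (f i)) refl })) ⟩
    F (f i) ℤ.+ 0ℤ ≡⟨ ℤ.+-identityʳ (F (f i)) ⟩
    F (f i) ∎
  fibre : ∀ j → ∑ᶠ N (λ i → if does (f i Fin.≟ j) then F j else 0ℤ) ≡ + r ℤ.* F j
  fibre j = begin
    ∑ᶠ N (λ i → if does (f i Fin.≟ j) then F j else 0ℤ) ≡⟨ ∑-filter (λ i → f i Fin.≟ j) (allFin N) (λ _ → F j) ⟩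
    ∑ (filter (λ i → f i Fin.≟ j) (allFin N)) (λ _ → F j) ≡⟨ ∑-const (filter (λ i → f i Fin.≟ j) (allFin N)) (F j) ⟩
    + length (filter (λ i → f i Fin.≟ j) (allFin N)) ℤ.* F j ≡⟨ cong (λ k → + k ℤ.* F j) (length-fibre j (size j)) ⟩
    + r ℤ.* F j ∎

-- For a nonzero integer the two sides begin with different constructors, so a single clause
-- remains.
i≡-i⇒i≡0 : ∀ {i} → i ≡ - i → i ≡ 0ℤ
i≡-i⇒i≡0 {+ 0} _ = refl

-- Hadamard codes

sgn-not : ∀ b → sgn (not b) ≡ - sgn b
sgn-not false = refl
sgn-not true  = refl

sgn² : ∀ b → sgn b ℤ.* sgn b ≡ + 1
sgn² false = refl
sgn² true  = refl

module _ {n : ℕ} where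

  complement : Vec Bool n → Vec Bool n
  complement = Vec.map not

  zeros : Vec Bool n
  zeros = Vec.replicate n false

  complement-involutive : ∀ v → complement (complement v) ≡ v
  complement-involutive v = trans (sym (Vec.map-∘ not not v))
    (trans (Vec.map-cong Bool.not-involutive v) (Vec.map-id v))

  inner : Vec Bool n → Vec Bool n → ℤ
  inner v w = ∑ᶠ n λ i → sgn (Vec.lookup v i) ℤ.* sgn (Vec.lookup w i)

  inner-self : ∀ v → inner v v ≡ + n
  inner-self v = trans (∑-cong (allFin n) (λ {i} _ → sgn² (Vec.lookup v i)))
    (trans (∑ᶠ-const n (+ 1)) (ℤ.*-identityʳ (+ n)))

  inner-complementˡ : ∀ v w → inner (complement v) w ≡ - inner v w
  inner-complementˡ v w = trans (∑-cong (allFin n) λ {i} _ → begin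
      sgn (Vec.lookup (complement v) i) ℤ.* sgn (Vec.lookup w i) ≡⟨ cong (λ b → sgn b ℤ.* sgn (Vec.lookup w i)) (Vec.lookup-map i not v) ⟩
      sgn (not (Vec.lookup v i)) ℤ.* sgn (Vec.lookup w i)        ≡⟨ cong (ℤ._* sgn (Vec.lookup w i)) (sgn-not (Vec.lookup v i)) ⟩
      - sgn (Vec.lookup v i) ℤ.* sgn (Vec.lookup w i)            ≡⟨ ℤ.neg-distribˡ-* (sgn (Vec.lookup v i)) (sgn (Vec.lookup w i)) ⟨
      - (sgn (Vec.lookup v i) ℤ.* sgn (Vec.lookup w i))          ∎)
    (∑-neg (allFin n) _)
    where open ≡-Reasoning

  inner-comm : ∀ v w → inner v w ≡ inner w v
  inner-comm v w = ∑-cong (allFin n) λ {i} _ → ℤ.*-comm (sgn (Vec.lookup v i)) (sgn (Vec.lookup w i))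

  inner-complementʳ : ∀ v w → inner v (complement w) ≡ - inner v w
  inner-complementʳ v w = trans (inner-comm v (complement w))
    (trans (inner-complementˡ w v) (cong -_ (inner-comm w v)))

  inner-tabulate : ∀ (f g : Fin n → Bool) →
                   inner (Vec.tabulate f) (Vec.tabulate g) ≡ ΣFin n (λ k → sgn (f k) ℤ.* sgn (g k))
  inner-tabulate f g = trans
    (∑-cong (allFin n) λ {i} _ → cong₂ (λ a b → sgn a ℤ.* sgn b) (Vec.lookup∘tabulate f i) (Vec.lookup∘tabulate g i))
    (sym (ΣFin≡∑ᶠ n _))

  module FromHadamard {S : Vec Bool n → Set} (S-hadamard : IsHadamardCode S) where

    private
      H = proj₁ S-hadamard
      open IsNormHadamard (proj₁ (proj₂ S-hadamard))
      S⇔ = proj₂ (proj₂ S-hadamard)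

      row : Fin n → Vec Bool n
      row i = Vec.tabulate (H i)

      rows-orthogonal : ∀ {i j} → i ≢ j → inner (row i) (row j) ≡ 0ℤ
      rows-orthogonal {i} {j} i≢j = trans (inner-tabulate (H i) (H j)) (orth-off i j i≢j)

    trichotomy : ∀ {v w} → S v → S w → v ≡ w ⊎ w ≡ complement v ⊎ inner v w ≡ 0ℤ
    trichotomy {v} {w} Sv Sw with proj₁ (S⇔ v) Sv | proj₁ (S⇔ w) Sw
    ... | i , v≡ | j , w≡ with i Fin.≟ j
    ... | yes refl = [ (λ { refl → [ (λ { refl → inj₁ refl }) , (λ { refl → inj₂ (inj₁ refl) }) ]′ w≡ })
                     , (λ { refl → [ (λ { refl → inj₂ (inj₁ (sym (complement-involutive (row i)))) }) , (λ { refl → inj₁ refl }) ]′ w≡ }) ]′ v≡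
    ... | no i≢j = inj₂ (inj₂ (orth v≡ w≡))
      where
      orth : v ≡ row i ⊎ v ≡ complement (row i) → w ≡ row j ⊎ w ≡ complement (row j) → inner v w ≡ 0ℤ
      orth (inj₁ refl) (inj₁ refl) = rows-orthogonal i≢j
      orth (inj₂ refl) (inj₁ refl) = trans (inner-complementˡ (row i) (row j)) (cong -_ (rows-orthogonal i≢j))
      orth (inj₁ refl) (inj₂ refl) = trans (inner-complementʳ (row i) (row j)) (cong -_ (rows-orthogonal i≢j))
      orth (inj₂ refl) (inj₂ refl) = trans (inner-complementˡ (row i) (complement (row j)))
        (cong -_ (trans (inner-complementʳ (row i) (row j)) (cong -_ (rows-orthogonal i≢j))))

    complement-closed : ∀ {v} → S v → S (complement v)
    complement-closed {v} Sv with proj₁ (S⇔ v) Sv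
    ... | i , inj₁ refl = proj₂ (S⇔ _) (i , inj₂ refl)
    ... | i , inj₂ refl = proj₂ (S⇔ _) (i , inj₁ (complement-involutive (row i)))

    -- Inner products separate the 2n words: a row has inner product n with itself, -n with its own
    -- complement, and 0 with every other row and its complement. For nonzero n these three values
    -- differ.
    size : n ≢ 0 → HasSize S (2 ℕ.* n)
    size n≢0 = rows List.++ List.map complement rows , unique , length≡ , λ v → (λ Sv → to (proj₁ (S⇔ v) Sv)) , from
      where
      rows = List.map row (allFin n)

      +n≢0 : + n ≢ 0ℤ
      +n≢0 p = n≢0 (ℤ.+-injective p)

      row-injective : ∀ {i j} → row i ≡ row j → i ≡ j
      row-injective {i} {j} p with i Fin.≟ j
      ... | yes i≡j = i≡j
      ... | no i≢j  = contradiction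
        (trans (sym (inner-self (row i))) (trans (cong (inner (row i)) p) (rows-orthogonal i≢j))) +n≢0

      row≢complement : ∀ i j → row i ≢ complement (row j)
      row≢complement i j p with i Fin.≟ j
      ... | yes refl = +n≢0 (i≡-i⇒i≡0 (begin
        + n                                ≡⟨ inner-self (row i) ⟨
        inner (row i) (row i)              ≡⟨ cong (inner (row i)) p ⟩
        inner (row i) (complement (row i)) ≡⟨ inner-complementʳ (row i) (row i) ⟩
        - inner (row i) (row i)            ≡⟨ cong -_ (inner-self (row i)) ⟩
        - + n                              ∎))
        where open ≡-Reasoning
      ... | no i≢j = +n≢0 (begin
        + n                                ≡⟨ inner-self (row i) ⟨
        inner (row i) (row i)              ≡⟨ cong (inner (row i)) p ⟩
        inner (row i) (complement (row j)) ≡⟨ inner-complementʳ (row i) (row j) ⟩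
        - inner (row i) (row j)            ≡⟨ cong -_ (rows-orthogonal i≢j) ⟩
        0ℤ                                 ∎)
        where open ≡-Reasoning

      complement-injective : ∀ {v w} → complement v ≡ complement w → v ≡ w
      complement-injective {v} {w} p =
        trans (sym (complement-involutive v)) (trans (cong complement p) (complement-involutive w))

      rows! : Unique rows
      rows! = Unique.map⁺ row-injective (Unique.allFin⁺ n)

      unique : Unique (rows List.++ List.map complement rows)
      unique = Unique.++⁺ rows! (Unique.map⁺ complement-injective rows!) disjoint
        where
        disjoint : ∀ {v} → ¬ (v ∈ rows × v ∈ List.map complement rows)
        disjoint (p , q) with ∈-map⁻ row p | ∈-map⁻ complement q
        ... | i , _ , refl | w , w∈ , eq with ∈-map⁻ row w∈
        ... | j , _ , refl = row≢complement i j eq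

      length≡ : length (rows List.++ List.map complement rows) ≡ 2 ℕ.* n
      length≡ = begin
        length (rows List.++ List.map complement rows)         ≡⟨ List.length-++ rows ⟩
        length rows ℕ.+ length (List.map complement rows)      ≡⟨ cong (length rows ℕ.+_) (List.length-map complement rows) ⟩
        length rows ℕ.+ length rows                            ≡⟨ cong (λ k → k ℕ.+ k) (trans (List.length-map row (allFin n)) (List.length-tabulate {n = n} (λ i → i))) ⟩
        n ℕ.+ n                                                ≡⟨ cong (n ℕ.+_) (ℕ.+-identityʳ n) ⟨
        2 ℕ.* n                                                ∎
        where open ≡-Reasoning

      to : ∀ {v} → Σ (Fin n) (λ i → v ≡ row i ⊎ v ≡ complement (row i)) → v ∈ rows List.++ List.map complement rows
      to (i , inj₁ refl) = ∈-++⁺ˡ (∈-map⁺ row (∈-allFin i))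
      to (i , inj₂ refl) = ∈-++⁺ʳ rows (∈-map⁺ complement (∈-map⁺ row (∈-allFin i)))

      from : ∀ {v} → v ∈ rows List.++ List.map complement rows → S v
      from v∈ with ∈-++⁻ rows v∈
      ... | inj₁ p with ∈-map⁻ row p
      ...   | i , _ , refl = proj₂ (S⇔ _) (i , inj₁ refl)
      from v∈ | inj₂ q with ∈-map⁻ complement q
      ...   | w , w∈ , refl with ∈-map⁻ row w∈
      ...     | i , _ , refl = proj₂ (S⇔ _) (i , inj₂ refl)

-- Normalized Hadamard matrices from sets of words

lookup-injective : ∀ {A : Set} {l : List A} → Unique l → ∀ i j → List.lookup l i ≡ List.lookup l j → i ≡ j
lookup-injective (_ ∷ _)  zero    zero    _  = refl
lookup-injective (p ∷ _)  zero    (suc j) eq = contradiction eq (All.lookup p (∈-lookup j))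
lookup-injective (p ∷ _)  (suc i) zero    eq = contradiction (sym eq) (All.lookup p (∈-lookup i))
lookup-injective (_ ∷ l!) (suc i) (suc j) eq = cong suc (lookup-injective l! i j eq)

-- Exactly one member of each pair of complementary words starts with 0. These words form `R`, half
-- of `W`, and serve as the rows. Choosing them by first entry normalizes the first column, and
-- moving the zero word to the front normalizes the first row.
module ToHadamard {n : ℕ} (W : List (Vec Bool (suc n))) (W! : Unique W) (length-W : length W ≡ 2 ℕ.* suc n)
  (zeros∈W : zeros ∈ W) (closed : ∀ {v} → v ∈ W → complement v ∈ W)
  (trichotomy : ∀ {v w} → v ∈ W → w ∈ W → v ≡ w ⊎ w ≡ complement v ⊎ inner v w ≡ 0ℤ) where

  private
    _≟ᵛ_ = Vec.≡-dec {n = suc n} Bool._≟_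

    head-false? : (v : Vec Bool (suc n)) → Dec (Vec.head v ≡ false)
    head-false? v = Vec.head v Bool.≟ false

    nonzero? : (v : Vec Bool (suc n)) → Dec (v ≢ zeros)
    nonzero? v = ¬? (v ≟ᵛ zeros)

    W₀ R : List (Vec Bool (suc n))
    W₀ = filter head-false? W
    R = zeros ∷ filter nonzero? W₀

    R! : Unique R
    R! = All.tabulate (λ x∈ zeros≡x → proj₂ (∈-filter⁻ nonzero? {xs = W₀} x∈) (sym zeros≡x))
       ∷ Unique.filter⁺ nonzero? (Unique.filter⁺ head-false? W!)

    ∈R⁻ : ∀ {v} → v ∈ R → v ∈ W × Vec.head v ≡ false
    ∈R⁻ (here refl) = zeros∈W , refl
    ∈R⁻ (there p)   = ∈-filter⁻ head-false? (proj₁ (∈-filter⁻ nonzero? {xs = W₀} p))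

    ∈R⁺ : ∀ {v} → v ∈ W → Vec.head v ≡ false → v ∈ R
    ∈R⁺ {v} v∈W h with v ≟ᵛ zeros
    ... | yes refl = here refl
    ... | no v≢0   = there (∈-filter⁺ nonzero? (∈-filter⁺ head-false? v∈W h) v≢0)

    head-complement : ∀ (v : Vec Bool (suc n)) → Vec.head (complement v) ≡ not (Vec.head v)
    head-complement (_ ∷ _) = refl

    split : ∀ {v} → v ∈ W → v ∈ R ⊎ complement v ∈ R
    split {v} v∈W with Vec.head v in eq
    ... | false = inj₁ (∈R⁺ v∈W eq)
    ... | true  = inj₂ (∈R⁺ (closed v∈W) (trans (head-complement v) (cong not eq)))

    head-clash : ∀ {v} → v ∈ R → complement v ∉ R
    head-clash {v} v∈ cv∈ = case
      (trans (sym (proj₂ (∈R⁻ cv∈))) (trans (head-complement v) (cong not (proj₂ (∈R⁻ v∈)))))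
      where
      case : false ≢ true
      case ()

    abstract
      length-R : suc n ≡ length R
      length-R = ℕ.*-cancelˡ-≡ (suc n) (length R) 2 (begin
        2 ℕ.* suc n                                  ≡⟨ length-W ⟨
        length W                                     ≡⟨ same-elements⇒length W! RR! W⊆ ⊆W ⟩
        length (R List.++ List.map complement R)     ≡⟨ List.length-++ R ⟩
        length R ℕ.+ length (List.map complement R)  ≡⟨ cong (length R ℕ.+_) (List.length-map complement R) ⟩
        length R ℕ.+ length R                        ≡⟨ cong (length R ℕ.+_) (ℕ.+-identityʳ (length R)) ⟨
        2 ℕ.* length R                               ∎)
        where
        open ≡-Reasoning
        RR! : Unique (R List.++ List.map complement R)
        RR! = Unique.++⁺ R!
          (Unique.map⁺ (λ {v} {w} p → trans (sym (complement-involutive v)) (trans (cong complement p) (complement-involutive w))) R!)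
          λ { (p , q) → let w , w∈ , eq = ∈-map⁻ complement q in head-clash w∈ (subst (_∈ R) eq p) }
        W⊆ : ∀ {v} → v ∈ W → v ∈ R List.++ List.map complement R
        W⊆ {v} v∈ with split v∈
        ... | inj₁ p = ∈-++⁺ˡ p
        ... | inj₂ q = ∈-++⁺ʳ R (subst (_∈ List.map complement R) (complement-involutive v) (∈-map⁺ complement q))
        ⊆W : ∀ {v} → v ∈ R List.++ List.map complement R → v ∈ W
        ⊆W v∈ with ∈-++⁻ R v∈
        ... | inj₁ p = proj₁ (∈R⁻ p)
        ... | inj₂ q with ∈-map⁻ complement q
        ...   | w , w∈ , refl = closed (proj₁ (∈R⁻ w∈))

    row : Fin (suc n) → Vec Bool (suc n)
    row i = List.lookup R (cast length-R i)

    row∈R : ∀ i → row i ∈ R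
    row∈R i = ∈-lookup (cast length-R i)

    row-surjective : ∀ {v} → v ∈ R → Σ (Fin (suc n)) λ i → v ≡ row i
    row-surjective v∈ = cast (sym length-R) (Any.index v∈) ,
      trans (lookup-index v∈) (cong (List.lookup R) (sym (Fin.cast-involutive length-R (sym length-R) (Any.index v∈))))

    row-injective : ∀ {i j} → row i ≡ row j → i ≡ j
    row-injective {i} {j} p = begin
      i                                        ≡⟨ Fin.cast-involutive (sym length-R) length-R i ⟨
      cast (sym length-R) (cast length-R i)    ≡⟨ cong (cast (sym length-R)) (lookup-injective R! (cast length-R i) (cast length-R j) p) ⟩
      cast (sym length-R) (cast length-R j)    ≡⟨ Fin.cast-involutive (sym length-R) length-R j ⟩
      j                                        ∎
      where open ≡-Reasoning

    H : Fin (suc n) → Fin (suc n) → Bool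
    H i = Vec.lookup (row i)

    H-hadamard : IsNormHadamard (suc n) H
    H-hadamard = record
      { orth-diag = λ i → trans (ΣFin≡∑ᶠ (suc n) (λ k → sgn (H i k) ℤ.* sgn (H i k))) (inner-self (row i))
      ; orth-off  = λ i j i≢j → trans (ΣFin≡∑ᶠ (suc n) (λ k → sgn (H i k) ℤ.* sgn (H j k))) (orth i j i≢j)
      -- `R` begins with `zeros` and `cast` sends `zero` to `zero`, so row 0 computes to the zero
      -- word.
      ; norm-row  = λ { zero j _ → Vec.lookup-replicate j false }
      ; norm-col  = λ { i zero _ → trans (lookup-zero (row i)) (proj₂ (∈R⁻ (row∈R i))) }
      }
      where
      lookup-zero : (v : Vec Bool (suc n)) → Vec.lookup v zero ≡ Vec.head v
      lookup-zero (_ ∷ _) = refl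
      orth : ∀ i j → i ≢ j → inner (row i) (row j) ≡ 0ℤ
      orth i j i≢j with trichotomy (proj₁ (∈R⁻ (row∈R i))) (proj₁ (∈R⁻ (row∈R j)))
      ... | inj₁ p = contradiction (row-injective p) i≢j
      ... | inj₂ (inj₁ p) = contradiction (subst (_∈ R) p (row∈R j)) (head-clash (row∈R i))
      ... | inj₂ (inj₂ p) = p

  isHadamardCode : {S : Vec Bool (suc n) → Set} → (∀ v → Iff (S v) (v ∈ W)) → IsHadamardCode S
  isHadamardCode {S} S⇔ = H , H-hadamard , λ v → to ∘ proj₁ (S⇔ v) , proj₂ (S⇔ v) ∘ from
    where
    to : ∀ {v} → v ∈ W → Σ (Fin (suc n)) λ i → v ≡ Vec.tabulate (H i) ⊎ v ≡ complement (Vec.tabulate (H i))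
    to {v} v∈ with split v∈
    ... | inj₁ p = let i , eq = row-surjective p in
      i , inj₁ (trans eq (sym (Vec.tabulate∘lookup (row i))))
    ... | inj₂ q = let i , eq = row-surjective q in
      i , inj₂ (trans (sym (complement-involutive v)) (cong complement (trans eq (sym (Vec.tabulate∘lookup (row i))))))
    from : ∀ {v} → Σ (Fin (suc n)) (λ i → v ≡ Vec.tabulate (H i) ⊎ v ≡ complement (Vec.tabulate (H i))) → v ∈ W
    from (i , inj₁ refl) = subst (_∈ W) (sym (Vec.tabulate∘lookup (row i))) (proj₁ (∈R⁻ (row∈R i)))
    from (i , inj₂ refl) = closed (subst (_∈ W) (sym (Vec.tabulate∘lookup (row i))) (proj₁ (∈R⁻ (row∈R i))))

isHadamardCode : ∀ {n} → n ≢ 0 → (W : List (Vec Bool n)) → Unique W → length W ≡ 2 ℕ.* n →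
  zeros ∈ W → (∀ {v} → v ∈ W → complement v ∈ W) →
  (∀ {v w} → v ∈ W → w ∈ W → v ≡ w ⊎ w ≡ complement v ⊎ inner v w ≡ 0ℤ) →
  {S : Vec Bool n → Set} → (∀ v → Iff (S v) (v ∈ W)) → IsHadamardCode S
isHadamardCode {zero}  n≢0 = contradiction refl n≢0
isHadamardCode {suc n} _   = ToHadamard.isHadamardCode

-- Characters of abelian subgroups

-- To be applied to characters with ν the negation: fixed points will become coordinates of Z2, and
-- orbits with two elements coordinates of Z4. Together with x its partner ν x is always included,
-- even if the list contains only x.
module Selection (X : DecSetoid 0ℓ 0ℓ) (ν : DecSetoid.Carrier X → DecSetoid.Carrier X)
  (ν-cong : ∀ {x y} → DecSetoid._≈_ X x y → DecSetoid._≈_ X (ν x) (ν y))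
  (ν-involutive : ∀ x → DecSetoid._≈_ X (ν (ν x)) x) where

  private
    module X = DecSetoid X
    open X using (Carrier; _≈_; _≟_)

  Occurs : ∀ {n} → Carrier → Vec Carrier n → Set
  Occurs x = VAny.Any (x ≈_)

  Distinct : ∀ {n} → Vec Carrier n → Set
  Distinct = AllPairs (λ x y → ¬ x ≈ y)

  -- The order z, ν z is that of the Gray map: the bits of x in Z4 are `bit x` and `bit (neg4 x)`.
  pairs : ∀ {n} → Vec Carrier n → Vec Carrier (n ℕ.* 2)
  pairs zs = Vec.concat (Vec.map (λ z → z ∷ ν z ∷ []) zs)

  private
    ¬occurs⇒all : ∀ {n x} {xs : Vec Carrier n} → ¬ Occurs x xs → VAll.All (λ y → ¬ x ≈ y) xs
    ¬occurs⇒all {xs = []}     p = []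
    ¬occurs⇒all {xs = y ∷ xs} p = (p ∘ here) ∷ ¬occurs⇒all (p ∘ there)

    occurs-resp : ∀ {n x y} {xs : Vec Carrier n} → x ≈ y → Occurs x xs → Occurs y xs
    occurs-resp x≈y = VAny.map (X.trans (X.sym x≈y))

    pairs-closed : ∀ {n x} (zs : Vec Carrier n) → Occurs x (pairs zs) → Occurs (ν x) (pairs zs)
    pairs-closed (z ∷ zs) (here p)          = there (here (ν-cong p))
    pairs-closed (z ∷ zs) (there (here p))  = here (X.trans (ν-cong p) (ν-involutive z))
    pairs-closed (z ∷ zs) (there (there p)) = there (there (pairs-closed zs p))

    Fixed : Carrier → Set
    Fixed x = ν x ≈ x

    fixed-reps : (l : List Carrier) → Σ ℕ λ a → Σ (Vec Carrier a) λ ys →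
      VAll.All Fixed ys × Distinct ys × (∀ {x} → x ∈ l → Fixed x → Occurs x ys)
    fixed-reps [] = 0 , [] , [] , [] , λ ()
    fixed-reps (x ∷ l) with fixed-reps l
    ... | a , ys , fixed , distinct , cover with ν x ≟ x | VAny.any? (x ≟_) ys
    ... | no ¬p | _ = a , ys , fixed , distinct , λ { (here refl) p → contradiction p ¬p ; (there q) → cover q }
    ... | yes _ | yes occurs = a , ys , fixed , distinct , λ { (here refl) _ → occurs ; (there q) → cover q }
    ... | yes p | no ¬occurs = suc a , x ∷ ys , p ∷ fixed , ¬occurs⇒all ¬occurs ∷ distinct ,
      λ { (here refl) _ → here X.refl ; (there q) → there ∘ cover q }

    paired-reps : (l : List Carrier) → Σ ℕ λ b → Σ (Vec Carrier b) λ zs →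
      VAll.All (¬_ ∘ Fixed) (pairs zs) × Distinct (pairs zs) × (∀ {x} → x ∈ l → ¬ Fixed x → Occurs x (pairs zs))
    paired-reps [] = 0 , [] , [] , [] , λ ()
    paired-reps (x ∷ l) with paired-reps l
    ... | b , zs , unfixed , distinct , cover with ν x ≟ x | VAny.any? (x ≟_) (pairs zs)
    ... | yes p | _ = b , zs , unfixed , distinct , λ { (here refl) ¬p → contradiction p ¬p ; (there q) → cover q }
    ... | no _  | yes occurs = b , zs , unfixed , distinct , λ { (here refl) _ → occurs ; (there q) → cover q }
    ... | no ¬p | no ¬occurs = suc b , x ∷ zs
      , ¬p ∷ (λ p → ¬p (X.trans (X.sym p) (ν-involutive x))) ∷ unfixed
      , ((λ p → ¬p (X.sym p)) ∷ ¬occurs⇒all ¬occurs)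
        -- The partner ν x is new as well: the chosen pairs are closed under ν, so an occurrence of
        -- ν x would give one of ν (ν x), which is x.
        ∷ ¬occurs⇒all (λ q → ¬occurs (occurs-resp (ν-involutive x) (pairs-closed zs q))) ∷ distinct
      , λ { (here refl) _ → here X.refl ; (there q) p → there (there (cover q p)) }

  record Representatives (l : List Carrier) : Set where
    field
      {a b} : ℕ
      ys : Vec Carrier a
      zs : Vec Carrier b
      ys-fixed : VAll.All (λ y → ν y ≈ y) ys

    -- Has the length  len a b 0  of the Gray image of Z2^a × Z4^b.
    all-reps : Vec Carrier (a ℕ.+ (b ℕ.* 2 ℕ.+ 0))
    all-reps = ys Vec.++ (pairs zs Vec.++ [])

    field
      distinct : Distinct all-reps
      cover    : ∀ {x} → x ∈ l → Occurs x all-reps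

  representatives : (l : List Carrier) → Representatives l
  representatives l =
    let a , ys , fixed , distinct-ys , cover-ys = fixed-reps l
        b , zs , unfixed , distinct-zs , cover-zs = paired-reps l
    in record
    { ys = ys ; zs = zs ; ys-fixed = fixed
    ; distinct = VAllPairs.++⁺ distinct-ys (VAllPairs.++⁺ distinct-zs [] (VAll.universal (λ _ → []) (pairs zs)))
        -- Being fixed by ν is invariant under the equivalence, so no fixed point is equivalent to a
        -- member of a pair.
        (VAll.map (λ {y} p → VAll.++⁺ (VAll.map (λ ¬q y≈z → ¬q (X.trans (ν-cong (X.sym y≈z)) (X.trans p y≈z))) unfixed) []) fixed)
    ; cover = λ {x} x∈l → cover {zs = zs} x∈l (ν x ≟ x) cover-ys cover-zs
    }
    where
    cover : ∀ {a b} {ys : Vec Carrier a} {zs : Vec Carrier b} {x} → x ∈ l → Dec (Fixed x) →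
            (∀ {x} → x ∈ l → Fixed x → Occurs x ys) → (∀ {x} → x ∈ l → ¬ Fixed x → Occurs x (pairs zs)) →
            Occurs x (ys Vec.++ (pairs zs Vec.++ []))
    cover x∈l (yes p) cover-ys _ = VAny.++⁺ˡ (cover-ys x∈l p)
    cover {ys = ys} x∈l (no ¬p) _ cover-zs = VAny.++⁺ʳ ys (VAny.++⁺ˡ (cover-zs x∈l ¬p))

-- The real part of (1 - i) i^x. It is not multiplicative, but adding 2 to x negates it.
sign : Z4 → ℤ
sign = sgn ∘ bit

module Characters {k1 k2 k3 : ℕ} {A : G k1 k2 k3 → Set} (A≤G : IsSubgroup A)
  (A-comm : ∀ {g h} → A g → A h → g · h ≡ h · g) (Au : A u)
  (l : List (G k1 k2 k3)) (l! : Unique l) (A⇔l : ∀ g → Iff (A g) (g ∈ l)) where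

  private
    Γ = G k1 k2 k3
    N = len k1 k2 k3
    open IsSubgroup A≤G
    open import Algebra.Properties.Group (G-group k1 k2 k3) using (∙-cancelˡ; \\-leftDividesˡ)

    ∈⇒A : ∀ {g} → g ∈ l → A g
    ∈⇒A = proj₂ (A⇔l _)

    A⇒∈ : ∀ {g} → A g → g ∈ l
    A⇒∈ = proj₁ (A⇔l _)

  -- `fn` is defined on the whole group so that each `θ i` can be taken as it is; since `θ i` is
  -- additive on commuting elements only, additivity and the equality `_≈_` refer to `A` alone.
  record Char : Set where
    field
      fn       : Γ → Z4
      additive : ∀ {g h} → A g → A h → fn (g · h) ≡ add4 (fn g) (fn h)
      at-u     : fn u ≡ c2

    at-e : fn e ≡ c0
    at-e = decide (∀₄? λ x → (x ≟₄ add4 x x) →-dec (x ≟₄ c0)) (fn e)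
      (trans (cong fn (sym (·-identityˡ e))) (additive has-e has-e))

    at-inv : ∀ {g} → A g → fn (g ⁻¹) ≡ neg4 (fn g)
    at-inv {g} Ag = decide (∀₄? λ x → ∀₄? λ y → (add4 x y ≟₄ c0) →-dec (x ≟₄ neg4 y)) (fn (g ⁻¹)) (fn g)
      (trans (sym (additive (inv-cl Ag) Ag)) (trans (cong fn (·-inverseˡ g)) at-e))

  open Char

  _≈_ : Char → Char → Set
  χ ≈ ψ = ∀ {g} → A g → fn χ g ≡ fn ψ g

  _≈?_ : ∀ χ ψ → Dec (χ ≈ ψ)
  χ ≈? ψ = map′ (λ p Ag → All.lookup p (A⇒∈ Ag)) (λ p → All.tabulate (p ∘ ∈⇒A))
    (All.all? (λ g → fn χ g ≟₄ fn ψ g) l)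

  Char-decSetoid : DecSetoid 0ℓ 0ℓ
  Char-decSetoid = record
    { Carrier = Char ; _≈_ = _≈_
    ; isDecEquivalence = record
      { isEquivalence = record
        { refl = λ _ → refl ; sym = λ p Ag → sym (p Ag) ; trans = λ p q Ag → trans (p Ag) (q Ag) }
      ; _≟_ = _≈?_ } }

  neg : Char → Char
  neg χ = record
    { fn = neg4 ∘ fn χ
    ; additive = λ {g} {h} Ag Ah → trans (cong neg4 (additive χ Ag Ah))
        (decide (∀₄? λ x → ∀₄? λ y → neg4 (add4 x y) ≟₄ add4 (neg4 x) (neg4 y)) (fn χ g) (fn χ h))
    ; at-u = cong neg4 (at-u χ) }

  coordinate : Fin N → Char
  coordinate i = record
    { fn = θ i ; additive = λ {g} {h} Ag Ah → θ-additive i g h (A-comm Ag Ah) ; at-u = θ-u {k1} {k2} {k3} i }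

  ∑-translate : ∀ {t} → A t → (F : Γ → ℤ) → ∑ l (λ g → F (t · g)) ≡ ∑ l F
  ∑-translate {t} At F = trans (sym (∑-map (t ·_) l F)) (∑-↭ F (same-elements⇒↭
    (Unique.map⁺ (λ {g} {h} → ∙-cancelˡ t g h) l!) l!
    (λ x∈ → let g , g∈ , eq = ∈-map⁻ (t ·_) x∈ in subst (_∈ l) (sym eq) (A⇒∈ (mul-cl At (∈⇒A g∈))))
    (λ {x} x∈ → subst (_∈ List.map (t ·_) l) (\\-leftDividesˡ t x)
      (∈-map⁺ (t ·_) (A⇒∈ (mul-cl (inv-cl At) (∈⇒A x∈)))))))

  -- Translation by t permutes A, so the sum equals its own negative.
  ∑-flip : ∀ {t} → A t → (F : Γ → ℤ) → (∀ {g} → A g → F (t · g) ≡ - F g) → ∑ l F ≡ 0ℤ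
  ∑-flip At F flip = i≡-i⇒i≡0 (trans (sym (∑-translate At F))
    (trans (∑-cong l (flip ∘ ∈⇒A)) (∑-neg l F)))

  private
    Even : Z4 → Set
    Even x = add4 x x ≡ c0

    even? : ∀ x → Dec (Even x)
    even? x = add4 x x ≟₄ c0

    _-₄_ : Z4 → Z4 → Z4
    x -₄ y = add4 x (neg4 y)

  -- If χ g − ψ g is odd for some g in A, translation by g² changes the sign of sign(χ)sign(ψ);
  -- otherwise sign(χ)sign(ψ) = sign(χ − ψ), and translation by any g with χ g ≠ ψ g changes its sign.
  characters-orthogonal : ∀ χ ψ → ¬ χ ≈ ψ → ∑ l (λ g → sign (fn χ g) ℤ.* sign (fn ψ g)) ≡ 0ℤ
  characters-orthogonal χ ψ χ≉ψ with Any.any? (λ g → ¬? (even? (fn χ g -₄ fn ψ g))) l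
  ... | yes p = ∑-flip (mul-cl At At) _ λ {g} Ag →
    trans (cong₂ (λ x y → sign x ℤ.* sign y) (shift χ Ag) (shift ψ Ag))
      -- If x - y is odd, exactly one of 2x and 2y equals 2, so exactly one of the two signs
      -- changes.
      (decide (∀₄? λ x → ∀₄? λ y → ∀₄? λ a → ∀₄? λ b → ¬? (even? (x -₄ y)) →-dec
        (sign (add4 (add4 x x) a) ℤ.* sign (add4 (add4 y y) b) ℤ.≟ - (sign a ℤ.* sign b)))
        (fn χ t) (fn ψ t) (fn χ g) (fn ψ g) (proj₂ (proj₂ (find p))))
    where
    t = proj₁ (find p)
    At : A t
    At = ∈⇒A (proj₁ (proj₂ (find p)))
    shift : ∀ (φ : Char) {g} → A g → fn φ ((t · t) · g) ≡ add4 (add4 (fn φ t) (fn φ t)) (fn φ g)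
    shift φ {g} Ag = trans (additive φ (mul-cl At At) Ag) (cong (λ x → add4 x (fn φ g)) (additive φ At At))
  ... | no ¬odd with Any.any? (λ g → ¬? (fn χ g ≟₄ fn ψ g)) l
  ...   | no ¬p = contradiction
    (λ {g} Ag → decidable-stable (fn χ g ≟₄ fn ψ g) λ q → ¬p (lose (A⇒∈ Ag) q)) χ≉ψ
  ...   | yes p = ∑-flip At _ λ {g} Ag →
    trans (cong₂ (λ x y → sign x ℤ.* sign y) (additive χ At Ag) (additive ψ At Ag))
      -- Here y = x + 2, while b is a or a + 2; since adding 2 negates a sign, the product of the
      -- signs changes.
      (decide (∀₄? λ x → ∀₄? λ y → ∀₄? λ a → ∀₄? λ b →
        even? (x -₄ y) →-dec even? (a -₄ b) →-dec ¬? (x ≟₄ y) →-dec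
        (sign (add4 x a) ℤ.* sign (add4 y b) ℤ.≟ - (sign a ℤ.* sign b)))
        (fn χ t) (fn ψ t) (fn χ g) (fn ψ g) (even At) (even Ag) (proj₂ (proj₂ (find p))))
    where
    t = proj₁ (find p)
    At : A t
    At = ∈⇒A (proj₁ (proj₂ (find p)))
    even : ∀ {g} → A g → Even (fn χ g -₄ fn ψ g)
    even {g} Ag = decidable-stable (even? (fn χ g -₄ fn ψ g)) λ q → ¬odd (lose (A⇒∈ Ag) q)

-- The short code of an abelian subgroup

zipWith-map-map : ∀ {X Y : Set} {_•_ : Y → Y → Y} {f g h : X → Y} {n} {xs : Vec X n} →
                  VAll.All (λ x → f x • g x ≡ h x) xs →
                  Vec.zipWith _•_ (Vec.map f xs) (Vec.map g xs) ≡ Vec.map h xs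
zipWith-map-map []       = refl
zipWith-map-map (p ∷ ps) = cong₂ _∷_ p (zipWith-map-map ps)

map-cong-All : ∀ {X Y : Set} {f g : X → Y} {n} {xs : Vec X n} →
               VAll.All (λ x → f x ≡ g x) xs → Vec.map f xs ≡ Vec.map g xs
map-cong-All []       = refl
map-cong-All (p ∷ ps) = cong₂ _∷_ p (map-cong-All ps)

unique-map-∈ : ∀ {X Y : Set} {f : X → Y} {l : List X} →
               (∀ {x y} → x ∈ l → y ∈ l → f x ≡ f y → x ≡ y) → Unique l → Unique (List.map f l)
unique-map-∈ inj []        = []
unique-map-∈ inj (x∉ ∷ l!) =
  All.map⁺ (All.tabulate λ y∈ eq → All.lookup x∉ y∈ (inj (here refl) (there y∈) eq))
  ∷ unique-map-∈ (λ x∈ y∈ → inj (there x∈) (there y∈)) l!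

module Reduction {k1 k2 k3 : ℕ} {A : G k1 k2 k3 → Set} (A≤G : IsSubgroup A)
  (A-comm : ∀ {g h} → A g → A h → g · h ≡ h · g) (Au : A u)
  (l : List (G k1 k2 k3)) (l! : Unique l) (A⇔l : ∀ g → Iff (A g) (g ∈ l))
  (A-trichotomy : ∀ {g h} → A g → A h → g ≡ h ⊎ h ≡ u · g ⊎ inner (Φ g) (Φ h) ≡ 0ℤ)
  (N≢0 : len k1 k2 k3 ≢ 0) where

  open Characters A≤G A-comm Au l l! A⇔l
  open Char
  open IsSubgroup A≤G

  private
    Γ = G k1 k2 k3
    N = len k1 k2 k3

    e' u' : Γ
    e' = e
    u' = u

    Φu : Φ u' ≡ complement (Φ e')
    Φu = trans (cong Φ (sym (·-identityʳ u'))) (Φ-u· e')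

    inner-e-e : inner (Φ e') (Φ e') ≡ + N
    inner-e-e = inner-self (Φ e')

    inner-u-e : inner (Φ u') (Φ e') ≡ - + N
    inner-u-e = trans (cong (λ v → inner v (Φ e')) Φu)
      (trans (inner-complementˡ (Φ e') (Φ e')) (cong -_ inner-e-e))

    u≢e : u' ≢ e'
    u≢e p = N≢0 (ℤ.+-injective (i≡-i⇒i≡0
      (trans (sym inner-e-e) (trans (cong (λ g → inner (Φ g) (Φ e')) (sym p)) inner-u-e))))

    e-orthogonal : ∀ {g} → A g → g ≢ e' → g ≢ u' → inner (Φ g) (Φ e') ≡ 0ℤ
    e-orthogonal {g} Ag g≢e g≢u with A-trichotomy has-e Ag
    ... | inj₁ p        = contradiction (sym p) g≢e
    ... | inj₂ (inj₁ p) = contradiction (trans p (·-identityʳ u')) g≢u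
    ... | inj₂ (inj₂ p) = trans (inner-comm (Φ g) (Φ e')) p

    ∑-e-u : ∀ (F : Γ → ℤ) → (∀ {g} → A g → g ≢ e' → g ≢ u' → F g ≡ 0ℤ) → ∑ l F ≡ F e' ℤ.+ F u'
    ∑-e-u F vanish = begin
      ∑ l F                           ≡⟨ ∑-↭ F (same-elements⇒↭ l! eu! to from) ⟩
      F e' ℤ.+ (F u' ℤ.+ ∑ rest F)    ≡⟨ cong (λ x → F e' ℤ.+ (F u' ℤ.+ x)) (∑-zero rest vanish-rest) ⟩
      F e' ℤ.+ (F u' ℤ.+ 0ℤ)          ≡⟨ cong (λ x → F e' ℤ.+ x) (ℤ.+-identityʳ (F u')) ⟩
      F e' ℤ.+ F u'                   ∎
      where
      open ≡-Reasoning
      other? : (g : Γ) → Dec (g ≢ e' × g ≢ u')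
      other? g = ¬? (g ≟G e') ×-dec ¬? (g ≟G u')
      rest = filter other? l
      rest⁻ : ∀ {g} → g ∈ rest → g ∈ l × (g ≢ e' × g ≢ u')
      rest⁻ = ∈-filter⁻ other? {xs = l}
      vanish-rest : ∀ {g} → g ∈ rest → F g ≡ 0ℤ
      vanish-rest g∈ = let g∈l , g≢e , g≢u = rest⁻ g∈ in vanish (proj₂ (A⇔l _) g∈l) g≢e g≢u
      eu! : Unique (e' ∷ u' ∷ rest)
      eu! = (u≢e ∘ sym ∷ All.tabulate (λ g∈ p → proj₁ (proj₂ (rest⁻ g∈)) (sym p)))
          ∷ All.tabulate (λ g∈ p → proj₂ (proj₂ (rest⁻ g∈)) (sym p))
          ∷ Unique.filter⁺ other? l!
      to : ∀ {g} → g ∈ l → g ∈ e' ∷ u' ∷ rest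
      to {g} g∈ with g ≟G e' | g ≟G u'
      ... | yes p | _     = here p
      ... | no _  | yes p = there (here p)
      ... | no p  | no q  = there (there (∈-filter⁺ other? g∈ (p , q)))
      from : ∀ {g} → g ∈ e' ∷ u' ∷ rest → g ∈ l
      from (here refl)         = proj₁ (A⇔l _) has-e
      from (there (here refl)) = proj₁ (A⇔l _) Au
      from (there (there g∈))  = proj₁ (rest⁻ g∈)

  coordinates-equal-to : Char → List (Fin N)
  coordinates-equal-to χ = filter (λ i → coordinate i ≈? χ) (allFin N)

  -- Both sides are the sum of sign (χ g) sign (θ i g) over all g in A and all coordinates i.
  count : ∀ χ → length (coordinates-equal-to χ) ℕ.* length l ≡ 2 ℕ.* N
  count χ = ℤ.+-injective (begin
    + (length (coordinates-equal-to χ) ℕ.* length l)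
      ≡⟨ ℤ.pos-* (length (coordinates-equal-to χ)) (length l) ⟩
    + length (coordinates-equal-to χ) ℤ.* + length l
      ≡⟨ ∑-const (coordinates-equal-to χ) (+ length l) ⟨
    ∑ (coordinates-equal-to χ) (λ _ → + length l)
      ≡⟨ ∑-filter (λ i → coordinate i ≈? χ) (allFin N) (λ _ → + length l) ⟨
    ∑ᶠ N (λ i → if does (coordinate i ≈? χ) then + length l else 0ℤ)
      ≡⟨ ∑-cong (allFin N) (λ {i} _ → column i (coordinate i ≈? χ)) ⟨
    ∑ᶠ N (λ i → ∑ l (λ g → sign (fn χ g) ℤ.* sign (θ i g)))
      ≡⟨ ∑-swap (allFin N) l (λ i g → sign (fn χ g) ℤ.* sign (θ i g)) ⟩
    ∑ l (λ g → ∑ᶠ N (λ i → sign (fn χ g) ℤ.* sign (θ i g)))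
      ≡⟨ ∑-cong l (λ {g} _ → row g) ⟩
    ∑ l (λ g → sign (fn χ g) ℤ.* inner (Φ g) (Φ e'))
      ≡⟨ ∑-e-u _ (λ {g} Ag p q → trans (cong (sign (fn χ g) ℤ.*_) (e-orthogonal Ag p q)) (ℤ.*-zeroʳ (sign (fn χ g)))) ⟩
    -- Both terms are N: at e the sign is 1 and the inner product N, while at u the value 2 of χ has
    -- sign -1 and the inner product is -N.
    sign (fn χ e') ℤ.* inner (Φ e') (Φ e') ℤ.+ sign (fn χ u') ℤ.* inner (Φ u') (Φ e')
      ≡⟨ cong₂ ℤ._+_ (cong₂ (λ x y → sign x ℤ.* y) (at-e χ) inner-e-e) (cong₂ (λ x y → sign x ℤ.* y) (at-u χ) inner-u-e) ⟩
    + 1 ℤ.* + N ℤ.+ ℤ.-1ℤ ℤ.* (- + N)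
      ≡⟨ cong₂ ℤ._+_ (ℤ.*-identityˡ (+ N)) (trans (ℤ.-1*i≡-i (- + N)) (ℤ.neg-involutive (+ N))) ⟩
    + (N ℕ.+ N)
      ≡⟨ cong (λ k → + (N ℕ.+ k)) (ℕ.+-identityʳ N) ⟨
    + (2 ℕ.* N) ∎)
    where
    open ≡-Reasoning
    column : ∀ i (χᵢ≈?χ : Dec (coordinate i ≈ χ)) →
             ∑ l (λ g → sign (fn χ g) ℤ.* sign (θ i g)) ≡ (if does χᵢ≈?χ then + length l else 0ℤ)
    column i (yes p) = begin
      ∑ l (λ g → sign (fn χ g) ℤ.* sign (θ i g)) ≡⟨ ∑-cong l (λ {g} g∈ → trans (cong (λ x → sign (fn χ g) ℤ.* sign x) (p (proj₂ (A⇔l g) g∈))) (sgn² (bit (fn χ g)))) ⟩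
      ∑ l (λ _ → + 1)                      ≡⟨ ∑-const l (+ 1) ⟩
      + length l ℤ.* + 1                   ≡⟨ ℤ.*-identityʳ (+ length l) ⟩
      + length l                           ∎
    column i (no ¬p) = characters-orthogonal χ (coordinate i) (λ q → ¬p (λ Ag → sym (q Ag)))
    -- The codeword of e is zero, so the sum of the signs of a codeword is its inner product with
    -- that of e; this makes orthogonality in the code applicable.
    row : ∀ g → ∑ᶠ N (λ i → sign (fn χ g) ℤ.* sign (θ i g)) ≡ sign (fn χ g) ℤ.* inner (Φ g) (Φ e')
    row g = trans (∑-*ˡ (allFin N) (sign (fn χ g)) (λ i → sign (θ i g))) (cong (sign (fn χ g) ℤ.*_)
      (∑-cong (allFin N) λ {i} _ → begin
        sign (θ i g)                                                   ≡⟨ cong sgn (bit-θ i g) ⟩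
        sgn (Vec.lookup (Φ g) i)                                    ≡⟨ ℤ.*-identityʳ (sgn (Vec.lookup (Φ g) i)) ⟨
        sgn (Vec.lookup (Φ g) i) ℤ.* sgn false                      ≡⟨ cong (λ b → sgn (Vec.lookup (Φ g) i) ℤ.* sgn b) (Φ-e-lookup i) ⟨
        sgn (Vec.lookup (Φ g) i) ℤ.* sgn (Vec.lookup (Φ e') i)      ∎))
      where
      Φ-e-lookup : ∀ i → Vec.lookup (Φ e') i ≡ false
      Φ-e-lookup i = trans (cong (λ v → Vec.lookup v i) (Φ-e {k1} {k2} {k3})) (Vec.lookup-replicate i false)

  module _ (r : ℕ) (2N≡r|A| : 2 ℕ.* N ≡ r ℕ.* length l) where

    private
      instance
        l-nonZero : ℕ.NonZero (length l)
        l-nonZero = ℕ.>-nonZero (nonempty (proj₁ (A⇔l _) has-e))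
          where
          nonempty : ∀ {g} {l : List Γ} → g ∈ l → 0 ℕ.< length l
          nonempty (here _)  = ℕ.s≤s ℕ.z≤n
          nonempty (there _) = ℕ.s≤s ℕ.z≤n

      -- The count holds for every `Char`, not only for those known to be coordinates. In particular
      -- both members of a pair of opposite characters occur r times, as the two columns of a Z4
      -- coordinate require.
      multiplicity : ∀ χ → HasSize (λ i → coordinate i ≈ χ) r
      multiplicity χ = coordinates-equal-to χ , Unique.filter⁺ _ (Unique.allFin⁺ N) ,
        ℕ.*-cancelʳ-≡ _ r (length l) (trans (count χ) 2N≡r|A|) ,
        λ i → (λ p → ∈-filter⁺ (λ i → coordinate i ≈? χ) (∈-allFin i) p) ,
              (λ i∈ → proj₂ (∈-filter⁻ (λ i → coordinate i ≈? χ) {xs = allFin N} i∈))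

      module Sel = Selection Char-decSetoid neg (λ p Ag → cong neg4 (p Ag))
        (λ χ {g} _ → decide (∀₄? λ x → neg4 (neg4 x) ≟₄ x) (fn χ g))
      open Sel using (pairs; module Representatives)
      open Representatives (Sel.representatives (List.map coordinate (allFin N)))

      n : ℕ
      n = len a b 0

      f : Fin N → Fin n
      f i = VAny.index (cover (∈-map⁺ coordinate (∈-allFin i)))

      f-spec : ∀ i → coordinate i ≈ Vec.lookup all-reps (f i)
      f-spec i = VAny.lookup-index (cover (∈-map⁺ coordinate (∈-allFin i)))

      -- The representatives are pairwise distinct on A, so f i = j holds exactly when coordinate i
      -- agrees on A with representative j.
      fibres : ∀ j → HasSize (λ i → f i ≡ j) r
      fibres j = let ix , ix! , len≡ , ix⇔ = multiplicity (Vec.lookup all-reps j) in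
        ix , ix! , len≡ , λ i →
          (λ { refl → proj₁ (ix⇔ i) (f-spec i) }) ,
          (λ i∈ → VUnique.lookup-injective (DecSetoid.setoid Char-decSetoid) distinct (f i) j
            λ Ag → trans (sym (f-spec i Ag)) (proj₂ (ix⇔ i) i∈ Ag))

      -- A character equal to its negative takes only the values 0 and 2 on A, and on these `bit` is
      -- a homomorphism to Z2.
      ψ : Γ → G a b 0
      ψ g = Vec.map (λ χ → bit (fn χ g)) ys , Vec.map (λ χ → fn χ g) zs , []

      Φ-ψ : ∀ g → Φ (ψ g) ≡ Vec.map (λ χ → bit (fn χ g)) all-reps
      Φ-ψ g = sym (trans (Vec.map-++ val ys (pairs zs Vec.++ []))
        (cong (Vec.map val ys Vec.++_) (trans (Vec.map-++ val (pairs zs) []) (cong (Vec._++ []) (gray zs)))))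
        where
        val = λ χ → bit (fn χ g)
        gray : ∀ {m} (zs : Vec Char m) → Vec.map val (pairs zs) ≡ Vec.concat (Vec.map ΦZ4 (Vec.map (λ χ → fn χ g) zs))
        gray []       = refl
        gray (z ∷ zs) = cong₂ Vec._++_
          (decide (∀₄? λ x → Vec.≡-dec Bool._≟_ (bit x ∷ bit (neg4 x) ∷ []) (ΦZ4 x)) (fn z g)) (gray zs)

      Φ-ψ-lookup : ∀ {g} → A g → ∀ i → Vec.lookup (Φ (ψ g)) (f i) ≡ Vec.lookup (Φ g) i
      Φ-ψ-lookup {g} Ag i = begin
        Vec.lookup (Φ (ψ g)) (f i)                                   ≡⟨ cong (λ v → Vec.lookup v (f i)) (Φ-ψ g) ⟩
        Vec.lookup (Vec.map (λ χ → bit (fn χ g)) all-reps) (f i)     ≡⟨ Vec.lookup-map (f i) (λ χ → bit (fn χ g)) all-reps ⟩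
        bit (fn (Vec.lookup all-reps (f i)) g)                       ≡⟨ cong bit (f-spec i Ag) ⟨
        bit (θ i g)                                                  ≡⟨ bit-θ i g ⟩
        Vec.lookup (Φ g) i                                           ∎
        where open ≡-Reasoning

      Φ≡repeated : ∀ {g} → A g → Φ g ≡ Vec.tabulate (λ i → Vec.lookup (Φ (ψ g)) (f i))
      Φ≡repeated {g} Ag = trans (sym (Vec.tabulate∘lookup (Φ g))) (Vec.tabulate-cong (sym ∘ Φ-ψ-lookup Ag))

      D : G a b 0 → Set
      D d = Σ Γ λ g → A g × d ≡ ψ g

      ψ-e : e ≡ ψ e'
      ψ-e = triple-≡
        (sym (trans (Vec.map-cong (λ χ → cong bit (at-e χ)) ys) (Vec.map-const ys false)))
        (sym (trans (Vec.map-cong at-e zs) (Vec.map-const zs c0)))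
        refl

      ψ-· : ∀ {g h} → A g → A h → ψ g · ψ h ≡ ψ (g · h)
      ψ-· {g} {h} Ag Ah = triple-≡
        (zipWith-map-map (VAll.map (λ {χ} fixed → trans
          (decide (∀₄? λ x → ∀₄? λ y → (neg4 x ≟₄ x) →-dec (neg4 y ≟₄ y) →-dec (bit x xor bit y Bool.≟ bit (add4 x y)))
            (fn χ g) (fn χ h) (fixed Ag) (fixed Ah)) (cong bit (sym (additive χ Ag Ah)))) ys-fixed))
        (zipWith-map-map (VAll.universal (λ χ → sym (additive χ Ag Ah)) zs))
        refl

      ψ-⁻¹ : ∀ {g} → A g → (ψ g) ⁻¹ ≡ ψ (g ⁻¹)
      ψ-⁻¹ {g} Ag = triple-≡
        (map-cong-All (VAll.map (λ {χ} fixed → cong bit (trans (sym (fixed Ag)) (sym (at-inv χ Ag)))) ys-fixed))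
        (trans (sym (Vec.map-∘ neg4 (λ χ → fn χ g) zs)) (Vec.map-cong (λ χ → sym (at-inv χ Ag)) zs))
        refl

      D≤G : IsSubgroup D
      D≤G = record
        { has-e  = e' , has-e , ψ-e
        ; mul-cl = λ { (g , Ag , refl) (h , Ah , refl) → g · h , mul-cl Ag Ah , ψ-· Ag Ah }
        ; inv-cl = λ { (g , Ag , refl) → g ⁻¹ , inv-cl Ag , ψ-⁻¹ Ag } }

      repetition : Repetition r (ImΦ A) (ImΦ D)
      repetition = f , fibres , λ w →
        (λ { (g , Ag , refl) → Φ (ψ g) , (ψ g , (g , Ag , refl) , refl) , Φ≡repeated Ag }) ,
        (λ { (_ , (_ , (g , Ag , refl) , refl) , refl) → g , Ag , Φ≡repeated Ag })

      -- Sum the constant 1 over all long coordinates, grouped by the fibres of `f`.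
      N≡rn : N ≡ r ℕ.* n
      N≡rn = ℤ.+-injective (begin
        + N                        ≡⟨ ℤ.*-identityʳ (+ N) ⟨
        + N ℤ.* + 1                ≡⟨ ∑ᶠ-const N (+ 1) ⟨
        ∑ᶠ N (λ _ → + 1)           ≡⟨ ∑ᶠ-repetition f fibres (λ _ → + 1) ⟩
        + r ℤ.* ∑ᶠ n (λ _ → + 1)   ≡⟨ cong (λ x → + r ℤ.* x) (trans (∑ᶠ-const n (+ 1)) (ℤ.*-identityʳ (+ n))) ⟩
        + r ℤ.* + n                ≡⟨ ℤ.pos-* r n ⟨
        + (r ℕ.* n)                ∎)
        where open ≡-Reasoning

      r≢0 : r ≢ 0
      r≢0 refl = N≢0 N≡rn

      n≢0 : n ≢ 0
      n≢0 p = N≢0 (trans N≡rn (trans (cong (r ℕ.*_) p) (ℕ.*-zeroʳ r)))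

      ψ-u : ψ u' ≡ u
      ψ-u = triple-≡
        (trans (Vec.map-cong (λ χ → cong bit (at-u χ)) ys) (Vec.map-const ys true))
        (trans (Vec.map-cong at-u zs) (Vec.map-const zs c2))
        refl

      Φ-ψ-u· : ∀ {g} → A g → Φ (ψ (u' · g)) ≡ complement (Φ (ψ g))
      Φ-ψ-u· {g} Ag = begin
        Φ (ψ (u' · g))        ≡⟨ cong Φ (ψ-· Au Ag) ⟨
        Φ (ψ u' · ψ g)        ≡⟨ cong (λ d → Φ (d · ψ g)) ψ-u ⟩
        Φ (u · ψ g)           ≡⟨ Φ-u· (ψ g) ⟩
        complement (Φ (ψ g))  ∎
        where open ≡-Reasoning

      -- Each short coordinate is read r times. As r is not 0, words whose repetitions are
      -- orthogonal are orthogonal themselves.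
      inner-repeated : ∀ {g h} → A g → A h → inner (Φ g) (Φ h) ≡ + r ℤ.* inner (Φ (ψ g)) (Φ (ψ h))
      inner-repeated {g} {h} Ag Ah = trans
        (∑-cong (allFin N) λ {i} _ → sym (cong₂ (λ x y → sgn x ℤ.* sgn y) (Φ-ψ-lookup Ag i) (Φ-ψ-lookup Ah i)))
        (∑ᶠ-repetition f fibres (λ j → sgn (Vec.lookup (Φ (ψ g)) j) ℤ.* sgn (Vec.lookup (Φ (ψ h)) j)))

      ψ-trichotomy : ∀ {g h} → A g → A h →
        Φ (ψ g) ≡ Φ (ψ h) ⊎ Φ (ψ h) ≡ complement (Φ (ψ g)) ⊎ inner (Φ (ψ g)) (Φ (ψ h)) ≡ 0ℤ
      ψ-trichotomy Ag Ah = Sum.map (cong (Φ ∘ ψ)) (Sum.map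
        (λ p → trans (cong (Φ ∘ ψ) p) (Φ-ψ-u· Ag))
        (λ p → cancel (trans (sym (inner-repeated Ag Ah)) p))) (A-trichotomy Ag Ah)
        where
        cancel : ∀ {x} → + r ℤ.* x ≡ 0ℤ → x ≡ 0ℤ
        cancel p with ℤ.i*j≡0⇒i≡0∨j≡0 (+ r) p
        ... | inj₁ r≡0 = contradiction (ℤ.+-injective r≡0) r≢0
        ... | inj₂ x≡0 = x≡0

      W : List (Vec Bool n)
      W = List.map (Φ ∘ ψ) l

      ∈W⁻ : ∀ {v} → v ∈ W → Σ Γ λ g → A g × v ≡ Φ (ψ g)
      ∈W⁻ v∈ = let g , g∈ , eq = ∈-map⁻ (Φ ∘ ψ) v∈ in g , proj₂ (A⇔l g) g∈ , eq

      ∈W⁺ : ∀ {g} → A g → Φ (ψ g) ∈ W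
      ∈W⁺ {g} Ag = ∈-map⁺ (Φ ∘ ψ) (proj₁ (A⇔l g) Ag)

      -- The long word of g is rebuilt from its short word, and the Gray map is injective; hence no
      -- two elements of A share a short word.
      W! : Unique W
      W! = unique-map-∈ (λ {g} {h} g∈ h∈ eq → Φ-injective g h (begin
        Φ g                                                   ≡⟨ Φ≡repeated (proj₂ (A⇔l g) g∈) ⟩
        Vec.tabulate (λ i → Vec.lookup (Φ (ψ g)) (f i))       ≡⟨ cong (λ v → Vec.tabulate (λ i → Vec.lookup v (f i))) eq ⟩
        Vec.tabulate (λ i → Vec.lookup (Φ (ψ h)) (f i))       ≡⟨ Φ≡repeated (proj₂ (A⇔l h) h∈) ⟨
        Φ h                                                   ∎)) l!
        where open ≡-Reasoning

      length-W : length W ≡ 2 ℕ.* n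
      length-W = trans (List.length-map (Φ ∘ ψ) l)
        (ℕ.*-cancelˡ-≡ (length l) (2 ℕ.* n) r ⦃ ℕ.≢-nonZero r≢0 ⦄ (begin
          r ℕ.* length l     ≡⟨ 2N≡r|A| ⟨
          2 ℕ.* N            ≡⟨ cong (2 ℕ.*_) N≡rn ⟩
          2 ℕ.* (r ℕ.* n)    ≡⟨ ℕ.*-assoc 2 r n ⟨
          2 ℕ.* r ℕ.* n      ≡⟨ cong (ℕ._* n) (ℕ.*-comm 2 r) ⟩
          r ℕ.* 2 ℕ.* n      ≡⟨ ℕ.*-assoc r 2 n ⟩
          r ℕ.* (2 ℕ.* n)    ∎))
        where open ≡-Reasoning

      D-hadamard : IsHadamardCode (ImΦ D)
      D-hadamard = isHadamardCode n≢0 W W! length-W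
        (subst (_∈ W) (trans (cong Φ (sym ψ-e)) (Φ-e {a} {b} {0})) (∈W⁺ has-e))
        (λ v∈ → let g , Ag , eq = ∈W⁻ v∈ in
          subst (_∈ W) (trans (Φ-ψ-u· Ag) (cong complement (sym eq))) (∈W⁺ (mul-cl Au Ag)))
        (λ v∈ w∈ → W-trichotomy (∈W⁻ v∈) (∈W⁻ w∈))
        (λ v → (λ { (_ , (g , Ag , refl) , refl) → ∈W⁺ Ag }) ,
               (λ v∈ → let g , Ag , eq = ∈W⁻ v∈ in ψ g , (g , Ag , refl) , sym eq))
        where
        W-trichotomy : ∀ {v w} → Σ Γ (λ g → A g × v ≡ Φ (ψ g)) → Σ Γ (λ h → A h × w ≡ Φ (ψ h)) →
                       v ≡ w ⊎ w ≡ complement v ⊎ inner v w ≡ 0ℤ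
        W-trichotomy (_ , Ag , refl) (_ , Ah , refl) = ψ-trichotomy Ag Ah

      -- A character fixed by negation takes the value 0 or 2 at z, hence 0 at z^2 = u, where it
      -- should be 2.
      no-Z2-part : (Σ Γ λ z → A z × sq z ≡ u) → a ≡ 0
      no-Z2-part (z , Az , z²≡u) = empty ys-fixed
        where
        empty : ∀ {m} {ys : Vec Char m} → VAll.All (λ y → neg y ≈ y) ys → m ≡ 0
        empty []                      = refl
        empty (_∷_ {x = χ} fixed _) = contradiction
          (trans (sym (additive χ Az Az)) (trans (cong (fn χ) z²≡u) (at-u χ)))
          (decide (∀₄? λ x → (neg4 x ≟₄ x) →-dec ¬? (add4 x x ≟₄ c2)) (fn χ z) (fixed Az))

    reduction : Σ ℕ λ a → Σ ℕ λ b → Σ (G a b 0 → Set) λ D →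
      (IsSubgroup D × IsHadamardCode (ImΦ D) × Repetition r (ImΦ A) (ImΦ D)) ×
      ((Σ Γ λ z → A z × sq z ≡ u) → a ≡ 0)
    reduction = a , b , D , (D≤G , D-hadamard , repetition) , no-Z2-part

-- Standard abelian subgroups

module _ {k1 k2 k3 : ℕ} where

  private
    Γ = G k1 k2 k3
    open import Algebra.Properties.Group (G-group k1 k2 k3)
      using (//-rightDividesˡ; //-rightDividesʳ; inverseˡ-unique)
    open ≡-Reasoning

  -- The exponent of the group divides 4, so inverses are cubes and closure under inverses reduces
  -- to closure under products.
  ⁻¹≡sq· : (g : Γ) → g ⁻¹ ≡ sq g · g
  ⁻¹≡sq· g = sym (inverseˡ-unique (sq g · g) g (trans (·-assoc (sq g) g g) (sq-sq g)))

  ·≡comm· : (g h : Γ) → g · h ≡ comm g h · (h · g)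
  ·≡comm· g h = begin
    g · h                                        ≡⟨ //-rightDividesˡ g (g · h) ⟨
    ((g · h) · (g ⁻¹)) · g                       ≡⟨ cong (_· g) (//-rightDividesˡ h ((g · h) · (g ⁻¹))) ⟨
    (comm g h · h) · g                           ≡⟨ ·-assoc (comm g h) h g ⟩
    comm g h · (h · g)                           ∎

  -- The relation [g, h] = q written without inverses, which makes it convenient for rewriting.
  Commute : Γ → Γ → Γ → Set
  Commute q g h = g · h ≡ q · (h · g)

  comm⇒Commute : ∀ {q} {g h : Γ} → comm g h ≡ q → Commute q g h
  comm⇒Commute {g = g} {h} refl = ·≡comm· g h

  Commute-e : ∀ {g h : Γ} → Commute e g h → g · h ≡ h · g
  Commute-e {g} {h} p = trans p (·-identityˡ (h · g))

  module _ (k : Γ) where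

    private
      q = sq k

      q-cancel : ∀ g → q · (q · g) ≡ g
      q-cancel g = trans (sym (·-assoc q q g)) (trans (cong (_· g) (sq-sq k)) (·-identityˡ g))

    sq-pull : ∀ g h → g · (q · h) ≡ q · (g · h)
    sq-pull g h = begin
      g · (q · h) ≡⟨ ·-assoc g q h ⟨
      (g · q) · h ≡⟨ cong (_· h) (sq-central k g) ⟨
      (q · g) · h ≡⟨ ·-assoc q g h ⟩
      q · (g · h) ∎

    -- The commutator [h, g] is the inverse of [g, h] = q, and the square q is its own inverse.
    Commute-sym : ∀ {g h : Γ} → Commute q g h → Commute q h g
    Commute-sym {g} {h} p = trans (sym (q-cancel (h · g))) (cong (q ·_) (sym p))

    -- Moving t past h and past g produces two factors q, which are central and cancel. In shape 2
    -- this makes z1 z2 commute with every later zj.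
    Commute-·ˡ : ∀ {g h t : Γ} → Commute q g t → Commute q h t → (g · h) · t ≡ t · (g · h)
    Commute-·ˡ {g} {h} {t} p p' = begin
      (g · h) · t            ≡⟨ ·-assoc g h t ⟩
      g · (h · t)            ≡⟨ cong (g ·_) p' ⟩
      g · (q · (t · h))      ≡⟨ sq-pull g (t · h) ⟩
      q · (g · (t · h))      ≡⟨ cong (q ·_) (·-assoc g t h) ⟨
      q · ((g · t) · h)      ≡⟨ cong (λ x → q · (x · h)) p ⟩
      q · ((q · (t · g)) · h) ≡⟨ cong (q ·_) (·-assoc q (t · g) h) ⟩
      q · (q · ((t · g) · h)) ≡⟨ q-cancel ((t · g) · h) ⟩
      (t · g) · h            ≡⟨ ·-assoc t g h ⟩
      t · (g · h)            ∎

    Commute⇒conjugate : ∀ {g h : Γ} → Commute q g h → g · h ≡ h · (q · g)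
    Commute⇒conjugate {g} {h} p = trans p (sym (sq-pull h g))

  -- As for i, j and ij in the quaternion group: (gh)^2 = g^2 (gh)(hg), and (gh)(hg) = g h^2 g = h^2
  -- g^2 = e.
  sq-· : ∀ {g h : Γ} → Commute (sq g) g h → sq g ≡ sq h → sq (g · h) ≡ sq g
  sq-· {g} {h} p g²≡h² = begin
    (g · h) · (g · h)               ≡⟨ cong ((g · h) ·_) p ⟩
    (g · h) · (sq g · (h · g))      ≡⟨ sq-pull g (g · h) (h · g) ⟩
    sq g · ((g · h) · (h · g))      ≡⟨ cong (sq g ·_) rest ⟩
    sq g · e                        ≡⟨ ·-identityʳ (sq g) ⟩
    sq g                            ∎
    where
    rest : (g · h) · (h · g) ≡ e
    rest = begin
      (g · h) · (h · g)   ≡⟨ ·-assoc g h (h · g) ⟩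
      g · (h · (h · g))   ≡⟨ cong (g ·_) (·-assoc h h g) ⟨
      g · (sq h · g)      ≡⟨ sq-pull h g g ⟩
      sq h · sq g         ≡⟨ cong (_· sq g) g²≡h² ⟨
      sq (sq g)           ≡⟨ sq-sq g ⟩
      e                   ∎

  Gen-∈ : ∀ {S} {s : Γ} → s ∈ S → Gen S s
  Gen-∈ {S} {s} s∈ = subst (Gen S) (·-identityʳ s) (gen-mul s∈ gen-e)

  Gen-· : ∀ {S} {g h : Γ} → Gen S g → Gen S h → Gen S (g · h)
  Gen-· {S} {h = h} gen-e q = subst (Gen S) (sym (·-identityˡ h)) q
  Gen-· {S} {h = h} (gen-mul {s} {g} s∈ p) q = subst (Gen S) (sym (·-assoc s g h)) (gen-mul s∈ (Gen-· p q))
  Gen-· {S} {h = h} (gen-inv {s} {g} s∈ p) q = subst (Gen S) (sym (·-assoc (s ⁻¹) g h)) (gen-inv s∈ (Gen-· p q))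

  Gen-isSubgroup : (S : List Γ) → IsSubgroup (Gen S)
  Gen-isSubgroup S = record
    { has-e = gen-e ; mul-cl = Gen-·
    ; inv-cl = λ {g} p → subst (Gen S) (sym (⁻¹≡sq· g)) (Gen-· (Gen-· p p) p) }

  Gen-⊆ : ∀ {C : Γ → Set} → IsSubgroup C → ∀ {S} → (∀ {s} → s ∈ S → C s) → ∀ {g} → Gen S g → C g
  Gen-⊆ C≤ S⊆C gen-e          = IsSubgroup.has-e C≤
  Gen-⊆ C≤ S⊆C (gen-mul s∈ p) = IsSubgroup.mul-cl C≤ (S⊆C s∈) (Gen-⊆ C≤ S⊆C p)
  Gen-⊆ C≤ S⊆C (gen-inv s∈ p) = IsSubgroup.mul-cl C≤ (IsSubgroup.inv-cl C≤ (S⊆C s∈)) (Gen-⊆ C≤ S⊆C p)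

  centralizer-isSubgroup : (x : Γ) → IsSubgroup (λ g → x · g ≡ g · x)
  centralizer-isSubgroup x = record { has-e = commutes-e ; mul-cl = commutes-· ; inv-cl = λ {g} → commutes-⁻¹ {g} }
    where
    commutes-e : x · e ≡ e · x
    commutes-e = trans (·-identityʳ x) (sym (·-identityˡ x))
    commutes-· : ∀ {g h} → x · g ≡ g · x → x · h ≡ h · x → x · (g · h) ≡ (g · h) · x
    commutes-· {g} {h} p q = begin
      x · (g · h)  ≡⟨ ·-assoc x g h ⟨
      (x · g) · h  ≡⟨ cong (_· h) p ⟩
      (g · x) · h  ≡⟨ ·-assoc g x h ⟩
      g · (x · h)  ≡⟨ cong (g ·_) q ⟩
      g · (h · x)  ≡⟨ ·-assoc g h x ⟨
      (g · h) · x  ∎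
    commutes-⁻¹ : ∀ {g} → x · g ≡ g · x → x · (g ⁻¹) ≡ (g ⁻¹) · x
    commutes-⁻¹ {g} p = subst (λ k → x · k ≡ k · x) (sym (⁻¹≡sq· g))
      (commutes-· (sym (sq-central g x)) p)

  -- Centralizers are subgroups: that of a generator t contains S, hence g; so that of g contains
  -- every generator, hence h.
  Gen-abelian : ∀ {S : List Γ} → (∀ {s t} → s ∈ S → t ∈ S → s · t ≡ t · s) →
                ∀ {g h} → Gen S g → Gen S h → g · h ≡ h · g
  Gen-abelian S-comm {g} {h} p q = Gen-⊆ (centralizer-isSubgroup g)
    (λ {t} t∈ → sym (Gen-⊆ (centralizer-isSubgroup t) (λ s∈ → S-comm t∈ s∈) p)) q

  -- A square has order at most 2. In shape 5 this determines a commutator as soon as it is known to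
  -- be nontrivial.
  Gen-sq : ∀ {k g : Γ} → Gen (sq k ∷ []) g → g ≡ e ⊎ g ≡ sq k
  Gen-sq gen-e = inj₁ refl
  Gen-sq {k} (gen-mul (here refl) p) with Gen-sq p
  ... | inj₁ refl = inj₂ (·-identityʳ (sq k))
  ... | inj₂ refl = inj₁ (sq-sq k)
  Gen-sq {k} (gen-inv (here refl) p) with Gen-sq p
  ... | inj₁ refl = inj₂ (trans (·-identityʳ (sq k ⁻¹)) (trans (⁻¹≡sq· (sq k)) (trans (cong (_· sq k) (sq-sq k)) (·-identityˡ (sq k)))))
  ... | inj₂ refl = inj₁ (·-inverseˡ (sq k))

  -- In shape 5 `stdA'` quantifies over w; uniqueness and existence of w identify it with one
  -- generated subgroup.
  F5-functional : ∀ {z z3 z4 w w' : Γ} → F5 z z3 z4 w → F5 z z3 z4 w' → w ≡ w'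
  F5-functional (inj₁ (_ , p)) (inj₁ (_ , q)) = trans p (sym q)
  F5-functional (inj₁ (p , _)) (inj₂ (inj₁ (¬p , _))) = contradiction p ¬p
  F5-functional (inj₁ (p , _)) (inj₂ (inj₂ (¬p , _))) = contradiction p ¬p
  F5-functional (inj₂ (inj₁ (¬p , _))) (inj₁ (p , _)) = contradiction p ¬p
  F5-functional (inj₂ (inj₁ (_ , _ , p))) (inj₂ (inj₁ (_ , _ , q))) = trans p (sym q)
  F5-functional (inj₂ (inj₁ (_ , p , _))) (inj₂ (inj₂ (_ , ¬p , _))) = contradiction p ¬p
  F5-functional (inj₂ (inj₂ (¬p , _))) (inj₁ (p , _)) = contradiction p ¬p
  F5-functional (inj₂ (inj₂ (_ , ¬p , _))) (inj₂ (inj₁ (_ , p , _))) = contradiction p ¬p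
  F5-functional (inj₂ (inj₂ (_ , _ , p))) (inj₂ (inj₂ (_ , _ , q))) = trans p (sym q)

  F5-total : ∀ (z z3 z4 : Γ) → Σ Γ (F5 z z3 z4)
  F5-total z z3 z4 with comm z z3 ≟G e | comm z z4 ≟G e
  ... | yes p | _     = z3 , inj₁ (p , refl)
  ... | no ¬p | yes q = z4 , inj₂ (inj₁ (¬p , q , refl))
  ... | no ¬p | no ¬q = z3 · z4 , inj₂ (inj₂ (¬p , ¬q , refl))

  record AbelianPart (C A : Γ → Set) : Set where
    field
      A≤G    : IsSubgroup A
      A⊆C    : ∀ {g} → A g → C g
      A-comm : ∀ {g h} → A g → A h → g · h ≡ h · g
      Au     : A u

  AbelianPart-resp-≐ : ∀ {C A A' : Γ → Set} → A ≐ A' → AbelianPart C A' → AbelianPart C A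
  AbelianPart-resp-≐ A≐A' part = record
    { A≤G = record
      { has-e = from has-e ; mul-cl = λ p q → from (mul-cl (to p) (to q)) ; inv-cl = λ p → from (inv-cl (to p)) }
    ; A⊆C = A⊆C ∘ to ; A-comm = λ p q → A-comm (to p) (to q) ; Au = from Au }
    where
    open AbelianPart part
    open IsSubgroup A≤G
    to = λ {g} → proj₁ (A≐A' g)
    from = λ {g} → proj₂ (A≐A' g)

  InCosets : (A : Γ → Set) (z g : Γ) → Set
  InCosets A z g = A g ⊎ Σ Γ λ a → A a × g ≡ z · a

  module _ {A : Γ → Set} (A≤G : IsSubgroup A) {z : Γ} (Az² : A (sq z)) where

    open IsSubgroup A≤G

    -- The union of A and zA is stable under left multiplication by each generator: z z a lies in A
    -- because z^2 does, and s z a = z s' a. Inverse generators are reduced to this by s^-1 = s^2 s,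
    -- where s^2 is central and lies in A.
    cosets-cover : ∀ {S} → (∀ {s} → s ∈ S → A (sq s)) →
      (∀ {s} → s ∈ S → s ≡ z ⊎ (A s × Σ Γ λ s' → A s' × s · z ≡ z · s')) →
      ∀ {g} → Gen S g → InCosets A z g
    cosets-cover {S} squares normal = go
      where
      multiply : ∀ {s h} → s ≡ z ⊎ (A s × Σ Γ λ s' → A s' × s · z ≡ z · s') → InCosets A z h → InCosets A z (s · h)
      multiply {h = h} (inj₁ refl) (inj₁ Ah) = inj₂ (h , Ah , refl)
      multiply (inj₁ refl) (inj₂ (a , Aa , refl)) = inj₁ (subst A (·-assoc z z a) (mul-cl Az² Aa))
      multiply (inj₂ (As , _)) (inj₁ Ah) = inj₁ (mul-cl As Ah)
      multiply {s} (inj₂ (_ , s' , As' , eq)) (inj₂ (a , Aa , refl)) = inj₂ (s' · a , mul-cl As' Aa ,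
        trans (sym (·-assoc s z a)) (trans (cong (_· a) eq) (·-assoc z s' a)))

      go : ∀ {g} → Gen S g → InCosets A z g
      go gen-e = inj₁ has-e
      go (gen-mul s∈ p) = multiply (normal s∈) (go p)
      go (gen-inv {s} {h} s∈ p) = subst (InCosets A z)
        (trans (sym (·-assoc (sq s) s h)) (cong (_· h) (sym (⁻¹≡sq· s))))
        (multiply (inj₂ (squares s∈ , sq s , squares s∈ , sq-central s z)) (multiply (normal s∈) (go p)))

  data Position (C A : Γ → Set) : Set where
    index≤2    : AbelianPart C A → (z : Γ) → (∀ {g} → C g → InCosets A z g) → Position C A
    has-root-u : AbelianPart C A → (Σ Γ λ z → A z × sq z ≡ u) → Position C A

  abelian : ∀ {C A} → Position C A → AbelianPart C A
  abelian (index≤2 part _ _)  = part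
  abelian (has-root-u part _) = part

  module _ {C : Γ → Set} (C≤G : IsSubgroup C) (Cu : C u) {xs ys zs : List Γ}
    (T-gen : T C ≐ Gen xs) (Z-gen : Z C ≐ Gen (xs List.++ ys)) (C-gen : C ≐ Gen (xs List.++ ys List.++ zs)) where

    private
      open IsSubgroup C≤G

      central : ∀ {x} → x ∈ xs List.++ ys → Z C x
      central x∈ = proj₂ (Z-gen _) (Gen-∈ x∈)

      zs⊆C : ∀ {z} → z ∈ zs → C z
      zs⊆C z∈ = proj₂ (C-gen _) (Gen-∈ (∈-++⁺ʳ xs (∈-++⁺ʳ ys z∈)))

      module _ {L : List Γ} where

        xs⊆ : ∀ {g} → Gen xs g → Gen (xs List.++ L) g
        xs⊆ = Gen-⊆ (Gen-isSubgroup _) (Gen-∈ ∘ ∈-++⁺ˡ)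

        L⊆ : ∀ {g} → g ∈ L → Gen (xs List.++ L) g
        L⊆ = Gen-∈ ∘ ∈-++⁺ʳ xs

        -- A square has order at most 2, so it lies in T(C), which is generated by `xs`.
        squares : ∀ {g} → C g → Gen (xs List.++ L) (sq g)
        squares {g} Cg = xs⊆ (proj₁ (T-gen _) (mul-cl Cg Cg , sq-sq g))

        abelianPart : (∀ {g} → g ∈ L → C g) → (∀ {g h} → g ∈ L → h ∈ L → g · h ≡ h · g) →
                      AbelianPart C (Gen (xs List.++ L))
        abelianPart L⊆C L-comm = record
          { A≤G = Gen-isSubgroup _ ; A⊆C = Gen-⊆ C≤G S⊆C ; A-comm = Gen-abelian S-comm
          ; Au = xs⊆ (proj₁ (T-gen _) (Cu , sq-u)) }
          where
          S⊆C : ∀ {g} → g ∈ xs List.++ L → C g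
          S⊆C g∈ with ∈-++⁻ xs g∈
          ... | inj₁ p = proj₁ (central (∈-++⁺ˡ p))
          ... | inj₂ p = L⊆C p
          S-comm : ∀ {g h} → g ∈ xs List.++ L → h ∈ xs List.++ L → g · h ≡ h · g
          S-comm g∈ h∈ with ∈-++⁻ xs g∈ | ∈-++⁻ xs h∈
          ... | inj₁ p | _      = proj₂ (central (∈-++⁺ˡ p)) _ (S⊆C h∈)
          ... | _      | inj₁ q = sym (proj₂ (central (∈-++⁺ˡ q)) _ (S⊆C g∈))
          ... | inj₂ p | inj₂ q = L-comm p q

        cover-by-cosets : ∀ {z} → C z →
          (∀ {s} → s ∈ ys List.++ zs → s ≡ z ⊎ (Gen (xs List.++ L) s × Σ Γ λ s' → Gen (xs List.++ L) s' × s · z ≡ z · s')) →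
          ∀ {g} → C g → InCosets (Gen (xs List.++ L)) z g
        cover-by-cosets {z} Cz normal Cg = cosets-cover (Gen-isSubgroup _) (squares Cz)
          (λ s∈ → squares (proj₂ (C-gen _) (Gen-∈ s∈))) normal' (proj₁ (C-gen _) Cg)
          where
          normal' : ∀ {s} → s ∈ xs List.++ ys List.++ zs →
            s ≡ z ⊎ (Gen (xs List.++ L) s × Σ Γ λ s' → Gen (xs List.++ L) s' × s · z ≡ z · s')
          normal' {s} s∈ with ∈-++⁻ xs s∈
          ... | inj₁ p = let As = xs⊆ (Gen-∈ p) in inj₂ (As , s , As , proj₂ (central (∈-++⁺ˡ p)) z Cz)
          ... | inj₂ p = normal p

      -- Without z-generators, C and its center are generated by the same list.
      abelian-whole : zs ≡ [] → AbelianPart C C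
      abelian-whole refl = record
        { A≤G = C≤G ; A⊆C = λ p → p
        ; A-comm = λ p q → proj₂ (proj₂ (Z-gen _) (subst (λ l → Gen (xs List.++ l) _) (List.++-identityʳ ys) (proj₁ (C-gen _) p))) _ q
        ; Au = Cu }

    position : (shape : Shape C ys zs) → Position C (stdA' xs shape)
    -- Here A = C, so the first coset already covers C and `e` merely fills the place of z.
    position (shape1 _)  = index≤2 (abelian-whole refl) e inj₁
    position (shape1* _) = index≤2 (abelian-whole refl) e inj₁
    position (shape2 z1 z2 rest z1² z2² [z1,z2] [zi,zj] [zj,zk]) = has-root-u
      (abelianPart (λ { (here refl) → mul-cl (zs⊆C (here refl)) (zs⊆C (there (here refl))) ; (there p) → zs⊆C (there (there p)) })
        λ { (here refl) (here refl) → refl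
          ; (here refl) (there q) → z1z2 q
          ; (there p) (here refl) → sym (z1z2 p)
          ; (there p) (there q) → Commute-e (comm⇒Commute ([zj,zk] p q)) })
      -- The root of u is the generator z1 z2: its square is z1^2 because [z1, z2] = z1^2 = z2^2.
      (z1 · z2 , L⊆ (here refl) , trans (sq-· (comm⇒Commute (trans [z1,z2] (sym z1²))) (trans z1² (sym z2²))) z1²)
      where
      z1z2 : ∀ {zj} → zj ∈ rest → (z1 · z2) · zj ≡ zj · (z1 · z2)
      z1z2 {zj} q = Commute-·ˡ zj (comm⇒Commute (proj₁ ([zi,zj] q))) (comm⇒Commute (proj₂ ([zi,zj] q)))
    position (shape3 z1 rest z1² _ [z1,zi] [zi,zj]) = index≤2
      (abelianPart (zs⊆C ∘ there) (λ p q → Commute-e (comm⇒Commute ([zi,zj] p q))))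
      z1 (cover-by-cosets (zs⊆C (here refl)) λ
        { (here refl) → inj₁ refl
        -- From [z1, s] = s^2 follows s z1 = z1 s^3, so conjugation by z1 inverts s and stays in A.
        ; {s} (there p) → inj₂ (L⊆ p , sq s · s , Gen-· (squares (zs⊆C (there p))) (L⊆ p) ,
            Commute⇒conjugate s (Commute-sym s (comm⇒Commute ([z1,zi] p)))) })
    position (shape4 z1 z2 z1²≡z2² [z1,z2] _) = index≤2
      (abelianPart (λ { (here refl) → zs⊆C (here refl) }) (λ { (here refl) (here refl) → refl }))
      z2 (cover-by-cosets (zs⊆C (there (here refl))) λ
        { (here refl) → inj₂ (L⊆ (here refl) , sq z1 · z1 , Gen-· (squares (zs⊆C (here refl))) (L⊆ (here refl)) ,
            Commute⇒conjugate z1 (comm⇒Commute [z1,z2]))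
        ; (there (here refl)) → inj₁ refl })
    position (shape4* y1 z1 z2 z1²≡z2² [z1,z2] _) = index≤2
      (abelianPart (λ { (here refl) → mul-cl (proj₁ y1-central) Cz1 ; (there (here refl)) → Cz1 })
        λ { (here refl) (here refl) → refl
          ; (here refl) (there (here refl)) → y1z1-z1
          ; (there (here refl)) (here refl) → sym y1z1-z1
          ; (there (here refl)) (there (here refl)) → refl })
      z2 (cover-by-cosets Cz2 λ
        { (here refl) → inj₂ (Ay1 , y1 , Ay1 , proj₂ y1-central z2 Cz2)
        ; (there (here refl)) → inj₂ (L⊆ (there (here refl)) , sq z1 · z1 , Gen-· (squares Cz1) (L⊆ (there (here refl))) ,
            Commute⇒conjugate z1 (comm⇒Commute [z1,z2]))
        ; (there (there (here refl))) → inj₁ refl })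
      where
      Cz1 = zs⊆C (here refl)
      Cz2 = zs⊆C (there (here refl))
      y1-central : Z C y1
      y1-central = central (∈-++⁺ʳ xs (here refl))
      y1z1-z1 : (y1 · z1) · z1 ≡ z1 · (y1 · z1)
      y1z1-z1 = trans (cong (_· z1) (proj₂ y1-central z1 Cz1)) (·-assoc z1 y1 z1)
      Ay1 : Gen (xs List.++ (y1 · z1) ∷ z1 ∷ []) y1
      Ay1 = subst (Gen _) (//-rightDividesʳ z1 y1)
        (Gen-· (L⊆ (here refl)) (IsSubgroup.inv-cl (Gen-isSubgroup _) (L⊆ (there (here refl)))))
    position (shape5 z1 z2 z3 z4 z1² z2² [z1,z2] z3²≡z4² [z3,z4] _ [zi,zj]) with F5-total z1 z3 z4
    ... | w , F5w = has-root-u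
      (AbelianPart-resp-≐ A≐ (abelianPart (λ { (here refl) → Cz1 ; (there (here refl)) → Cw F5w })
        λ { (here refl) (here refl) → refl
          ; (here refl) (there (here refl)) → z1-w F5w
          ; (there (here refl)) (here refl) → sym (z1-w F5w)
          ; (there (here refl)) (there (here refl)) → refl }))
      (z1 , (w , F5w , L⊆ (here refl)) , z1²)
      where
      Cz1 = zs⊆C (here refl)
      Cz3 = zs⊆C (there (there (here refl)))
      Cz4 = zs⊆C (there (there (there (here refl))))
      A≐ : (λ g → Σ Γ λ w → F5 z1 z3 z4 w × Gen (xs List.++ z1 ∷ w ∷ []) g) ≐ Gen (xs List.++ z1 ∷ w ∷ [])
      A≐ g = (λ { (w' , F5w' , p) → subst (λ w → Gen (xs List.++ z1 ∷ w ∷ []) g) (F5-functional F5w' F5w) p })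
           , (λ p → w , F5w , p)
      Cw : ∀ {w} → F5 z1 z3 z4 w → C w
      Cw (inj₁ (_ , refl)) = Cz3
      Cw (inj₂ (inj₁ (_ , _ , refl))) = Cz4
      Cw (inj₂ (inj₂ (_ , _ , refl))) = mul-cl Cz3 Cz4
      z1-w : ∀ {w} → F5 z1 z3 z4 w → z1 · w ≡ w · z1
      z1-w (inj₁ (p , refl)) = Commute-e (comm⇒Commute p)
      z1-w (inj₂ (inj₁ (_ , p , refl))) = Commute-e (comm⇒Commute p)
      -- When z1 commutes with neither z3 nor z4, both commutators equal z3^2 = z4^2, so they cancel
      -- in the product z3 z4. This is the reason for the last case of f.
      z1-w (inj₂ (inj₂ (¬p , ¬q , refl))) with Gen-sq ([zi,zj] (here refl) (here refl)) | Gen-sq ([zi,zj] (here refl) (there (here refl)))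
      ... | inj₁ p | _      = contradiction p ¬p
      ... | _      | inj₁ q = contradiction q ¬q
      ... | inj₂ p | inj₂ q = sym (Commute-·ˡ z3 (Commute-sym z3 (comm⇒Commute p))
        (Commute-sym z3 (comm⇒Commute (trans q (sym z3²≡z4²)))))

-- Index of the standard subgroup and conclusion

module _ {k1 k2 k3 : ℕ} where

  private
    Γ = G k1 k2 k3

  -- Two cosets hold at most 2|A| elements, which is less than 4|A| because A contains e.
  cosets-cover⇒index≢4 : ∀ {C A : Γ → Set} {z} → A e → (∀ {g} → C g → InCosets A z g) → ¬ IndexIs C A 2
  cosets-cover⇒index≢4 {z = z} Ae cover (n , (l , l! , refl , A⇔l) , (m , m! , m≡4n , C⇔m)) =
    ℕ.<⇒≱ 2n<4n (begin
      2 ^ 2 ℕ.* n                               ≡⟨ m≡4n ⟨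
      length m                                  ≤⟨ unique-⊆⇒length-≤ _≟G_ m! (λ g∈ → ⊆cosets (cover (proj₂ (C⇔m _) g∈))) ⟩
      length (l List.++ List.map (z ·_) l)      ≡⟨ List.length-++ l ⟩
      n ℕ.+ length (List.map (z ·_) l)          ≡⟨ cong (n ℕ.+_) (List.length-map (z ·_) l) ⟩
      n ℕ.+ n                                   ≡⟨ cong (n ℕ.+_) (ℕ.+-identityʳ n) ⟨
      2 ℕ.* n                                   ∎)
    where
    open ℕ.≤-Reasoning
    nonempty : ∀ {g} {l : List Γ} → g ∈ l → ℕ.NonZero (length l)
    nonempty (here _)  = _
    nonempty (there _) = _
    2n<4n : 2 ℕ.* n ℕ.< 4 ℕ.* n
    2n<4n = ℕ.*-monoˡ-< n ⦃ nonempty (proj₁ (A⇔l e) Ae) ⦄ {2} {4} (ℕ.s≤s (ℕ.s≤s (ℕ.s≤s ℕ.z≤n)))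
    ⊆cosets : ∀ {g} → InCosets _ z g → g ∈ l List.++ List.map (z ·_) l
    ⊆cosets (inj₁ Ag)              = ∈-++⁺ˡ (proj₁ (A⇔l _) Ag)
    ⊆cosets (inj₂ (a , Aa , refl)) = ∈-++⁺ʳ l (∈-map⁺ (z ·_) (proj₁ (A⇔l a) Aa))

  module _ {C : Γ → Set} (C≤G : IsSubgroup C) (N≢0 : len k1 k2 k3 ≢ 0) (C-hadamard : IsHadamardCode (ImΦ C)) where

    private
      open IsSubgroup C≤G
      module Code = FromHadamard C-hadamard

      C-trichotomy : ∀ {g h} → C g → C h → g ≡ h ⊎ h ≡ u · g ⊎ inner (Φ g) (Φ h) ≡ 0ℤ
      C-trichotomy {g} {h} Cg Ch = Sum.map (Φ-injective g h)
        (Sum.map (λ p → Φ-injective h (u · g) (trans p (sym (Φ-u· g)))) (λ p → p))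
        (Code.trichotomy (g , Cg , refl) (h , Ch , refl))

      -- The Gray map is injective, so C has as many elements as its code has words.
      size-C : ∀ {n} → HasSize C n → n ≡ 2 ℕ.* len k1 k2 k3
      size-C (l , l! , refl , C⇔l) = HasSize-unique
        ( List.map Φ l , Unique.map⁺ (Φ-injective _ _) l! , List.length-map Φ l
        , λ v → (λ { (g , Cg , refl) → ∈-map⁺ Φ (proj₁ (C⇔l g) Cg) })
              , (λ v∈ → let g , g∈ , eq = ∈-map⁻ Φ v∈ in g , proj₂ (C⇔l g) g∈ , sym eq) )
        (Code.size N≢0)

    -- The complement of the zero word, the image of e, is again a codeword, and its only preimage
    -- is u.
    u∈C : C u
    u∈C with Code.complement-closed (e {k1} {k2} {k3} , has-e , refl)
    ... | g , Cg , eq = subst C (trans (Φ-injective g (u · e) (trans eq (sym (Φ-u· {k1} {k2} {k3} e)))) (·-identityʳ u)) Cg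

    abelianPart-reduction : ∀ {A} → AbelianPart C A → ∀ υ → IndexIs C A υ →
      Σ ℕ λ a → Σ ℕ λ b → Σ (G a b 0 → Set) λ D →
        (IsSubgroup D × IsHadamardCode (ImΦ D) × Repetition (2 ^ υ) (ImΦ A) (ImΦ D)) ×
        ((Σ Γ λ z → A z × sq z ≡ u) → a ≡ 0)
    abelianPart-reduction part υ (n , (l , l! , refl , A⇔l) , size) =
      Reduction.reduction A≤G A-comm Au l l! A⇔l (λ Ag Ah → C-trichotomy (A⊆C Ag) (A⊆C Ah)) N≢0
        (2 ^ υ) (sym (size-C size))
      where open AbelianPart part

    duplication : ∀ {A} → AbelianPart C A → IndexIs C A 1 → DuplicationOfHadamardZ2Z4 (ImΦ A)
    duplication part index = let a , b , D , p , _ = abelianPart-reduction part 1 index in a , b , D , p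

    quadruplication : ∀ {A} → Position C A → IndexIs C A 2 → QuadruplicationOfHadamardZ4 (ImΦ A)
    quadruplication (index≤2 part z cover) index =
      contradiction index (cosets-cover⇒index≢4 (IsSubgroup.has-e (AbelianPart.A≤G part)) cover)
    quadruplication (has-root-u part root) index with abelianPart-reduction part 2 index
    ... | a , b , D , p , no-Z2 with no-Z2 root
    ...   | refl = b , D , p

mainTheorem3 : ∀ {k1 k2 k3 : ℕ} (m : ℕ) (C : G k1 k2 k3 → Set) →
    IsSubgroup C → len k1 k2 k3 ≡ 2 ^ m → IsHadamardCode (ImΦ C) →
    (ng : NormGens C) →
    (IndexIs C (stdA ng) 1 → DuplicationOfHadamardZ2Z4 (ImΦ (stdA ng))) ×
    (IndexIs C (stdA ng) 2 → QuadruplicationOfHadamardZ4 (ImΦ (stdA ng)))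
mainTheorem3 {k1} {k2} {k3} m C C≤G N≡2^m C-hadamard ng =
  duplication C≤G N≢0 C-hadamard (abelian pos) , quadruplication C≤G N≢0 C-hadamard pos
  where
  open NormGens ng
  N≢0 : len k1 k2 k3 ≢ 0
  N≢0 N≡0 = ℕ.≢-nonZero⁻¹ (2 ^ m) ⦃ ℕ.m^n≢0 2 m ⦄ (trans (sym N≡2^m) N≡0)
  pos : Position C (stdA ng)
  pos = position C≤G (u∈C C≤G N≢0 C-hadamard) T-gen Z-gen C-gen shape
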